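{- Let $G$ be a simple connected graph with at least two vertices and diameter $D$. Then \[ \lambda_1(G) \geq \frac{4}{D\cdot \mathrm{vol}(G)}. \]
   Context: For a simple graph $G$ with degree function $d$, the normalized Laplacian is $\mathcal{L}=I-T^{ -1/2}AT^{ -1/2}$, where $A$ is the adjacency matrix and $T$ the diagonal degree matrix. Its eigenvalues are $0=\lambda_0\le\lambda_1\le\dots\le\lambda_{n-1}\le 2$, and for connected $G$ \[ \lambda_1=\inf_{f\neq 0,\ \sum_u f(u)d(u)=0}\frac{\sum_{u\sim v}(f(u)-f(v))^2}{\sum_v f(v)^2 d(v)}, \] where the sum in the numerator is over edges. $\mathrm{vol}(G)=\sum_{u\in V(G)} d(u)$. -}

module Defs where

open import Algebra.Bundles.Raw using (RawMonoid)
import Algebra.Definitions.RawMonoid as RawMonoidDefs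
open import Data.Empty using (⊥)
open import Data.Fin.Base as Fin using (Fin; zero; suc)
import Data.Fin.Properties as Fin
open import Data.Integer.Base as ℤ using (+_)
import Data.Integer.Properties as ℤ
open import Data.List.Base as List using (allFin; filter)
import Data.List.Properties as List
open import Data.List.Membership.Propositional using (lose)
open import Data.List.Membership.Propositional.Properties using (∈-allFin)
open import Data.Nat.Base as ℕ using (ℕ; zero; suc; z≤n; s≤s; NonZero)
import Data.Nat.Properties as ℕ
import Data.Nat.Solver as ℕ-Solver
open import Data.Product.Base using (∃; ∃₂; _×_; _,_)
open import Data.Rational.Base as ℚ using (ℚ; mkℚ; 0ℚ; 1ℚ; ½; _/_)
import Data.Rational.Properties as ℚ
import Data.Rational.Solver as ℚ-Solver
open import Data.Rational.Unnormalised.Base as ℚᵘ using (mkℚᵘ)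
import Data.Rational.Unnormalised.Properties as ℚᵘ
open import Data.Sum.Base using (inj₁; inj₂)
open import Data.Vec.Functional using (Vector)
open import Level using (0ℓ)
open import Relation.Binary.Construct.Closure.ReflexiveTransitive using (Star; ε; _◅_)
open import Relation.Binary.Core using (Rel)
open import Relation.Binary.Definitions using (Decidable; Irreflexive; Symmetric)
open import Relation.Binary.PropositionalEquality
  using (_≡_; refl; sym; trans; cong; cong₂; subst; subst₂)
open import Relation.Nullary using (¬_; yes; no; does; contradiction)
open import Data.Bool.Base using (if_then_else_)

∣∣≤ : ∀ {p ε} → p ℚ.≤ ε → ℚ.- p ℚ.≤ ε → ℚ.∣ p ∣ ℚ.≤ ε
∣∣≤ {p} p≤ε -p≤ε with ℚ.∣p∣≡p∨∣p∣≡-p p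
... | inj₁ eq = subst (ℚ._≤ _) (sym eq) p≤ε
... | inj₂ eq = subst (ℚ._≤ _) (sym eq) -p≤ε

½*pos : ∀ {δ} → 0ℚ ℚ.< δ → 0ℚ ℚ.< ½ ℚ.* δ
½*pos {δ} 0<δ = subst (ℚ._< ½ ℚ.* δ) (ℚ.*-zeroʳ ½) (ℚ.*-monoʳ-<-pos ½ 0<δ)

½+½ : ∀ δ → ½ ℚ.* δ ℚ.+ ½ ℚ.* δ ≡ δ
½+½ δ = trans (sym (ℚ.*-distribʳ-+ δ ½ ½)) (ℚ.*-identityˡ δ)

shrink : ∀ B δ → 0ℚ ℚ.≤ B → 0ℚ ℚ.< δ → ∃ λ η → 0ℚ ℚ.< η × B ℚ.* η ℚ.≤ δ
shrink B δ 0≤B 0<δ = η , 0<η , Bη≤δ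
  where
  C = B ℚ.+ 1ℚ
  C-pos : ℚ.Positive C
  C-pos = ℚ.positive (ℚ.+-mono-≤-< 0≤B (ℚ.positive⁻¹ 1ℚ))
  C-nonZero : ℚ.NonZero C
  C-nonZero = ℚ.pos⇒nonZero C {{C-pos}}
  1/C = (ℚ.1/ C) {{C-nonZero}}
  η = 1/C ℚ.* δ
  0<η : 0ℚ ℚ.< η
  0<η = subst (ℚ._< η) (ℚ.*-zeroʳ 1/C)
    (ℚ.*-monoʳ-<-pos 1/C {{ℚ.1/pos⇒pos C {{C-pos}}}} 0<δ)
  B≤C : B ℚ.≤ C
  B≤C = subst (ℚ._≤ C) (ℚ.+-identityʳ B) (ℚ.+-monoʳ-≤ B (ℚ.nonNegative⁻¹ 1ℚ))
  Cη≡δ : C ℚ.* η ≡ δ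
  Cη≡δ = trans (sym (ℚ.*-assoc C 1/C δ))
    (trans (cong (ℚ._* δ) (ℚ.*-inverseʳ C {{C-nonZero}})) (ℚ.*-identityˡ δ))
  Bη≤δ : B ℚ.* η ℚ.≤ δ
  Bη≤δ = subst (B ℚ.* η ℚ.≤_) Cη≡δ
    (ℚ.*-monoʳ-≤-nonNeg η {{ℚ.nonNegative (ℚ.<⇒≤ 0<η)}} B≤C)

*-mono-≤-0≤ : ∀ {p q r s} → 0ℚ ℚ.≤ r → 0ℚ ℚ.≤ q → p ℚ.≤ q → r ℚ.≤ s → p ℚ.* r ℚ.≤ q ℚ.* s
*-mono-≤-0≤ {p} {q} {r} {s} 0≤r 0≤q p≤q r≤s =
  ℚ.≤-trans (ℚ.*-monoʳ-≤-nonNeg r {{ℚ.nonNegative 0≤r}} p≤q)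
            (ℚ.*-monoˡ-≤-nonNeg q {{ℚ.nonNegative 0≤q}} r≤s)

0≤∣_∣ : ∀ p → 0ℚ ℚ.≤ ℚ.∣ p ∣
0≤∣ p ∣ = ℚ.nonNegative⁻¹ ℚ.∣ p ∣ {{ℚ.∣-∣-nonNeg p}}

-- Real numbers are Cauchy sequences of rationals, identified up to _≈ᵣ_.
IsCauchy : (ℕ → ℚ) → Set
IsCauchy x = ∀ δ → 0ℚ ℚ.< δ →
  ∃ λ N → ∀ m n → N ℕ.≤ m → N ℕ.≤ n → ℚ.∣ x m ℚ.- x n ∣ ℚ.≤ δ

record ℝ : Set where
  constructor mkℝ
  field
    seq    : ℕ → ℚ
    cauchy : IsCauchy seq

open ℝ public

infix  4 _≈ᵣ_ _≤ᵣ_ _≥ᵣ_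
infixl 6 _+ᵣ_ _-ᵣ_
infixl 7 _*ᵣ_
infix  8 -ᵣ_

_≈ᵣ_ : Rel ℝ 0ℓ
x ≈ᵣ y = ∀ δ → 0ℚ ℚ.< δ →
  ∃ λ N → ∀ n → N ℕ.≤ n → ℚ.∣ seq x n ℚ.- seq y n ∣ ℚ.≤ δ

_≤ᵣ_ : Rel ℝ 0ℓ
x ≤ᵣ y = ∀ δ → 0ℚ ℚ.< δ →
  ∃ λ N → ∀ n → N ℕ.≤ n → seq x n ℚ.≤ seq y n ℚ.+ δ

_≥ᵣ_ : Rel ℝ 0ℓ
x ≥ᵣ y = y ≤ᵣ x

fromℚ : ℚ → ℝ
fromℚ p = mkℝ (λ _ → p) λ δ 0<δ → 0 , λ _ _ _ _ →
  subst (λ q → ℚ.∣ q ∣ ℚ.≤ δ) (sym (ℚ.+-inverseʳ p)) (ℚ.<⇒≤ 0<δ)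

0ᵣ 1ᵣ : ℝ
0ᵣ = fromℚ 0ℚ
1ᵣ = fromℚ 1ℚ

_+ᵣ_ : ℝ → ℝ → ℝ
x +ᵣ y = mkℝ (λ n → seq x n ℚ.+ seq y n) +-cauchy
  where
  open ℚ-Solver.+-*-Solver
  interchange : ∀ a b c d → (a ℚ.+ b) ℚ.- (c ℚ.+ d) ≡ (a ℚ.- c) ℚ.+ (b ℚ.- d)
  interchange = solve 4 (λ a b c d → (a :+ b) :- (c :+ d) := (a :- c) :+ (b :- d)) refl
  +-cauchy : IsCauchy (λ n → seq x n ℚ.+ seq y n)
  +-cauchy δ 0<δ
    with N₁ , h₁ ← cauchy x (½ ℚ.* δ) (½*pos 0<δ)
       | N₂ , h₂ ← cauchy y (½ ℚ.* δ) (½*pos 0<δ) = N₁ ℕ.⊔ N₂ , λ m n N≤m N≤n →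
    let open ℚ.≤-Reasoning
        m₁ = ℕ.m⊔n≤o⇒m≤o N₁ N₂ N≤m ; m₂ = ℕ.m⊔n≤o⇒n≤o N₁ N₂ N≤m
        n₁ = ℕ.m⊔n≤o⇒m≤o N₁ N₂ N≤n ; n₂ = ℕ.m⊔n≤o⇒n≤o N₁ N₂ N≤n
    in begin
      ℚ.∣ (seq x m ℚ.+ seq y m) ℚ.- (seq x n ℚ.+ seq y n) ∣
        ≡⟨ cong ℚ.∣_∣ (interchange (seq x m) (seq y m) (seq x n) (seq y n)) ⟩
      ℚ.∣ (seq x m ℚ.- seq x n) ℚ.+ (seq y m ℚ.- seq y n) ∣
        ≤⟨ ℚ.∣p+q∣≤∣p∣+∣q∣ (seq x m ℚ.- seq x n) (seq y m ℚ.- seq y n) ⟩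
      ℚ.∣ seq x m ℚ.- seq x n ∣ ℚ.+ ℚ.∣ seq y m ℚ.- seq y n ∣
        ≤⟨ ℚ.+-mono-≤ (h₁ m n m₁ n₁) (h₂ m n m₂ n₂) ⟩
      ½ ℚ.* δ ℚ.+ ½ ℚ.* δ
        ≡⟨ ½+½ δ ⟩
      δ ∎

-ᵣ_ : ℝ → ℝ
-ᵣ x = mkℝ (λ n → ℚ.- seq x n) λ δ 0<δ →
  let N , h = cauchy x δ 0<δ in
  N , λ m n N≤m N≤n → subst (ℚ._≤ δ)
    (trans (sym (ℚ.∣-p∣≡∣p∣ (seq x m ℚ.- seq x n)))
           (cong ℚ.∣_∣ (ℚ.neg-distrib-+ (seq x m) (ℚ.- seq x n))))
    (h m n N≤m N≤n)

_-ᵣ_ : ℝ → ℝ → ℝ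
x -ᵣ y = x +ᵣ (-ᵣ y)

eventually-bounded : ∀ x → ∃₂ λ N B → 0ℚ ℚ.≤ B × (∀ n → N ℕ.≤ n → ℚ.∣ seq x n ∣ ℚ.≤ B)
eventually-bounded x with N , h ← cauchy x 1ℚ (ℚ.positive⁻¹ 1ℚ) =
  N , 1ℚ ℚ.+ ℚ.∣ seq x N ∣ , ℚ.+-mono-≤ (ℚ.nonNegative⁻¹ 1ℚ) 0≤∣ seq x N ∣ , bound
  where
  open ℚ-Solver.+-*-Solver
  open ℚ.≤-Reasoning
  bound : ∀ n → N ℕ.≤ n → ℚ.∣ seq x n ∣ ℚ.≤ 1ℚ ℚ.+ ℚ.∣ seq x N ∣
  bound n N≤n = begin
    ℚ.∣ seq x n ∣
      ≡⟨ cong ℚ.∣_∣ (solve 2 (λ a b → a := (a :- b) :+ b) refl (seq x n) (seq x N)) ⟩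
    ℚ.∣ (seq x n ℚ.- seq x N) ℚ.+ seq x N ∣
      ≤⟨ ℚ.∣p+q∣≤∣p∣+∣q∣ (seq x n ℚ.- seq x N) (seq x N) ⟩
    ℚ.∣ seq x n ℚ.- seq x N ∣ ℚ.+ ℚ.∣ seq x N ∣
      ≤⟨ ℚ.+-monoˡ-≤ ℚ.∣ seq x N ∣ (h n N N≤n ℕ.≤-refl) ⟩
    1ℚ ℚ.+ ℚ.∣ seq x N ∣ ∎

-- ab - cd = a(b - d) + d(a - c), with each factor bounded.
product-near : ∀ {δ A B α β} a b c d → 0ℚ ℚ.≤ A → 0ℚ ℚ.≤ B →
  A ℚ.* α ℚ.≤ ½ ℚ.* δ → B ℚ.* β ℚ.≤ ½ ℚ.* δ →
  ℚ.∣ a ∣ ℚ.≤ A → ℚ.∣ b ℚ.- d ∣ ℚ.≤ α → ℚ.∣ d ∣ ℚ.≤ B → ℚ.∣ a ℚ.- c ∣ ℚ.≤ β →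
  ℚ.∣ a ℚ.* b ℚ.- c ℚ.* d ∣ ℚ.≤ δ
product-near {δ} {A} {B} {α} {β} a b c d 0≤A 0≤B Aα≤ Bβ≤ a≤ b-d≤ d≤ a-c≤ = begin
  ℚ.∣ a ℚ.* b ℚ.- c ℚ.* d ∣
    ≡⟨ cong ℚ.∣_∣ split ⟩
  ℚ.∣ a ℚ.* (b ℚ.- d) ℚ.+ d ℚ.* (a ℚ.- c) ∣
    ≤⟨ ℚ.∣p+q∣≤∣p∣+∣q∣ (a ℚ.* (b ℚ.- d)) (d ℚ.* (a ℚ.- c)) ⟩
  ℚ.∣ a ℚ.* (b ℚ.- d) ∣ ℚ.+ ℚ.∣ d ℚ.* (a ℚ.- c) ∣
    ≡⟨ cong₂ ℚ._+_ (ℚ.∣p*q∣≡∣p∣*∣q∣ a (b ℚ.- d)) (ℚ.∣p*q∣≡∣p∣*∣q∣ d (a ℚ.- c)) ⟩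
  ℚ.∣ a ∣ ℚ.* ℚ.∣ b ℚ.- d ∣ ℚ.+ ℚ.∣ d ∣ ℚ.* ℚ.∣ a ℚ.- c ∣
    ≤⟨ ℚ.+-mono-≤ {ℚ.∣ a ∣ ℚ.* ℚ.∣ b ℚ.- d ∣} {A ℚ.* α} {ℚ.∣ d ∣ ℚ.* ℚ.∣ a ℚ.- c ∣} {B ℚ.* β}
         (*-mono-≤-0≤ {ℚ.∣ a ∣} {A} {ℚ.∣ b ℚ.- d ∣} {α} 0≤∣ b ℚ.- d ∣ 0≤A a≤ b-d≤)
         (*-mono-≤-0≤ {ℚ.∣ d ∣} {B} {ℚ.∣ a ℚ.- c ∣} {β} 0≤∣ a ℚ.- c ∣ 0≤B d≤ a-c≤) ⟩
  A ℚ.* α ℚ.+ B ℚ.* β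
    ≤⟨ ℚ.+-mono-≤ {A ℚ.* α} {½ ℚ.* δ} {B ℚ.* β} {½ ℚ.* δ} Aα≤ Bβ≤ ⟩
  ½ ℚ.* δ ℚ.+ ½ ℚ.* δ
    ≡⟨ ½+½ δ ⟩
  δ ∎
  where
  open ℚ.≤-Reasoning
  open ℚ-Solver.+-*-Solver
  telescope : ∀ p q r → p ℚ.- r ≡ (p ℚ.- q) ℚ.+ (q ℚ.- r)
  telescope = solve 3 (λ p q r → p :- r := (p :- q) :+ (q :- r)) refl
  factor : ∀ p q r → p ℚ.* q ℚ.- p ℚ.* r ≡ p ℚ.* (q ℚ.- r)
  factor p q r = trans (cong (p ℚ.* q ℚ.+_) (ℚ.neg-distribʳ-* p r)) (sym (ℚ.*-distribˡ-+ p q (ℚ.- r)))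
  split : a ℚ.* b ℚ.- c ℚ.* d ≡ a ℚ.* (b ℚ.- d) ℚ.+ d ℚ.* (a ℚ.- c)
  split = trans (telescope (a ℚ.* b) (a ℚ.* d) (c ℚ.* d))
    (cong₂ ℚ._+_ (factor a b d)
      (trans (cong₂ ℚ._-_ (ℚ.*-comm a d) (ℚ.*-comm c d)) (factor d a c)))

*-cauchy : ∀ x y → IsCauchy (λ n → seq x n ℚ.* seq y n)
*-cauchy x y δ 0<δ =
  let N₁ , A , 0≤A , x≤A = eventually-bounded x
      N₂ , B , 0≤B , y≤B = eventually-bounded y
      α , 0<α , Aα≤ = shrink A (½ ℚ.* δ) 0≤A (½*pos 0<δ)
      β , 0<β , Bβ≤ = shrink B (½ ℚ.* δ) 0≤B (½*pos 0<δ)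
      N₃ , y-near = cauchy y α 0<α
      N₄ , x-near = cauchy x β 0<β
      N₁₂ = N₁ ℕ.⊔ N₂
      N₃₄ = N₃ ℕ.⊔ N₄
  in N₁₂ ℕ.⊔ N₃₄ , λ m n N≤m N≤n →
    let N₁₂≤m = ℕ.m⊔n≤o⇒m≤o N₁₂ N₃₄ N≤m
        N₃₄≤m = ℕ.m⊔n≤o⇒n≤o N₁₂ N₃₄ N≤m
        N₁₂≤n = ℕ.m⊔n≤o⇒m≤o N₁₂ N₃₄ N≤n
        N₃₄≤n = ℕ.m⊔n≤o⇒n≤o N₁₂ N₃₄ N≤n
    in product-near {δ} {A} {B} {α} {β} (seq x m) (seq y m) (seq x n) (seq y n) 0≤A 0≤B Aα≤ Bβ≤
      (x≤A m (ℕ.m⊔n≤o⇒m≤o N₁ N₂ N₁₂≤m))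
      (y-near m n (ℕ.m⊔n≤o⇒m≤o N₃ N₄ N₃₄≤m) (ℕ.m⊔n≤o⇒m≤o N₃ N₄ N₃₄≤n))
      (y≤B n (ℕ.m⊔n≤o⇒n≤o N₁ N₂ N₁₂≤n))
      (x-near m n (ℕ.m⊔n≤o⇒n≤o N₃ N₄ N₃₄≤m) (ℕ.m⊔n≤o⇒n≤o N₃ N₄ N₃₄≤n))

_*ᵣ_ : ℝ → ℝ → ℝ
x *ᵣ y = mkℝ (λ n → seq x n ℚ.* seq y n) (*-cauchy x y)

-- The greatest j ≤ b with j² d ≤ K².
root : (d K b : ℕ) → ℕ
root d K zero = 0
root d K (suc b) with suc b ℕ.* suc b ℕ.* d ℕ.≤? K ℕ.* K
... | yes _ = suc b
... | no  _ = root d K b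

-- With K = k + 1 and d ≥ 1, the greatest j with j² d ≤ K² is at most K and
-- satisfies j / K ≤ 1 / √d < (j + 1) / K.
invSqrtSeq : (d : ℕ) → ℕ → ℚ
invSqrtSeq d k = + root d (suc k) (suc k) / suc k

root-lower : ∀ d K b → root d K b ℕ.* root d K b ℕ.* d ℕ.≤ K ℕ.* K
root-lower d K zero = z≤n
root-lower d K (suc b) with suc b ℕ.* suc b ℕ.* d ℕ.≤? K ℕ.* K
... | yes p = p
... | no  _ = root-lower d K b

root-upper : ∀ d K b → K ℕ.* K ℕ.< suc b ℕ.* suc b ℕ.* d →
  K ℕ.* K ℕ.< suc (root d K b) ℕ.* suc (root d K b) ℕ.* d
root-upper d K zero p = p
root-upper d K (suc b) p with suc b ℕ.* suc b ℕ.* d ℕ.≤? K ℕ.* K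
... | yes _ = p
... | no  q = root-upper d K b (ℕ.≰⇒> q)

root-upper′ : ∀ d K → K ℕ.* K ℕ.< suc (root (suc d) K K) ℕ.* suc (root (suc d) K K) ℕ.* suc d
root-upper′ d K = root-upper (suc d) K K
  (ℕ.<-≤-trans (ℕ.*-mono-< (ℕ.n<1+n K) (ℕ.n<1+n K)) (ℕ.m≤m*n (suc K ℕ.* suc K) (suc d)))

root-cross : ∀ d a K b L → .{{NonZero K}} → .{{NonZero L}} →
  a ℕ.* a ℕ.* d ℕ.≤ K ℕ.* K → L ℕ.* L ℕ.< b ℕ.* b ℕ.* d → a ℕ.* L ℕ.≤ b ℕ.* K
root-cross d a K b L a²d≤K² L²<b²d = ℕ.≮⇒≥ λ bK<aL → ℕ.<-irrefl refl (begin-strict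
  b ℕ.* K ℕ.* (b ℕ.* K) ℕ.* d   ≤⟨ ℕ.*-monoˡ-≤ d (ℕ.*-mono-≤ (ℕ.<⇒≤ bK<aL) (ℕ.<⇒≤ bK<aL)) ⟩
  a ℕ.* L ℕ.* (a ℕ.* L) ℕ.* d   ≡⟨ regroup a L d ⟩
  a ℕ.* a ℕ.* d ℕ.* (L ℕ.* L)   ≤⟨ ℕ.*-monoˡ-≤ (L ℕ.* L) a²d≤K² ⟩
  K ℕ.* K ℕ.* (L ℕ.* L)         <⟨ ℕ.*-monoʳ-< (K ℕ.* K) {{ℕ.m*n≢0 K K}} L²<b²d ⟩
  K ℕ.* K ℕ.* (b ℕ.* b ℕ.* d)   ≡⟨ ℕ.*-comm (K ℕ.* K) _ ⟩
  b ℕ.* b ℕ.* d ℕ.* (K ℕ.* K)   ≡⟨ regroup b K d ⟨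
  b ℕ.* K ℕ.* (b ℕ.* K) ℕ.* d   ∎)
  where
  open ℕ.≤-Reasoning
  open ℕ-Solver.+-*-Solver
  regroup : ∀ a L d → a ℕ.* L ℕ.* (a ℕ.* L) ℕ.* d ≡ a ℕ.* a ℕ.* d ℕ.* (L ℕ.* L)
  regroup = solve 3 (λ a L d → a :* L :* (a :* L) :* d := a :* a :* d :* (L :* L)) refl

/-mono-≤ : ∀ a k b l → a ℕ.* suc l ℕ.≤ b ℕ.* suc k → + a / suc k ℚ.≤ + b / suc l
/-mono-≤ a k b l p = ℚ.toℚᵘ-cancel-≤
  (ℚᵘ.≤-trans (ℚᵘ.≤-reflexive (ℚ.toℚᵘ-fromℚᵘ (mkℚᵘ (+ a) k)))
  (ℚᵘ.≤-trans (ℚᵘ.*≤* (subst₂ ℤ._≤_ (ℤ.pos-* a (suc l)) (ℤ.pos-* b (suc k)) (ℤ.+≤+ p)))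
              (ℚᵘ.≤-reflexive (ℚᵘ.≃-sym (ℚ.toℚᵘ-fromℚᵘ (mkℚᵘ (+ b) l))))))

suc-/ : ∀ b l → + suc b / suc l ≡ + 1 / suc l ℚ.+ + b / suc l
suc-/ b l = ℚ.toℚᵘ-injective
  (ℚᵘ.≃-trans (ℚ.toℚᵘ-fromℚᵘ (mkℚᵘ (+ suc b) l))
  (ℚᵘ.≃-trans (ℚᵘ.*≡* eq)
  (ℚᵘ.≃-trans (ℚᵘ.+-cong (ℚᵘ.≃-sym (ℚ.toℚᵘ-fromℚᵘ (mkℚᵘ (+ 1) l)))
                         (ℚᵘ.≃-sym (ℚ.toℚᵘ-fromℚᵘ (mkℚᵘ (+ b) l))))
              (ℚᵘ.≃-sym (ℚ.toℚᵘ-homo-+ (+ 1 / suc l) (+ b / suc l))))))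
  where
  L = + suc l
  eq : (+ suc b) ℤ.* (L ℤ.* L) ≡ ((+ 1) ℤ.* L ℤ.+ (+ b) ℤ.* L) ℤ.* L
  eq = trans (sym (ℤ.*-assoc (+ suc b) L L))
             (cong (ℤ._* L) (ℤ.*-distribʳ-+ L (+ 1) (+ b)))

invSqrt-near : ∀ d k l → invSqrtSeq (suc d) k ℚ.- invSqrtSeq (suc d) l ℚ.≤ + 1 / suc l
invSqrt-near d k l = begin
  x ℚ.- y                      ≤⟨ ℚ.+-monoˡ-≤ (ℚ.- y) x≤ ⟩
  (+ 1 / suc l ℚ.+ y) ℚ.- y    ≡⟨ solve 2 (λ a b → (a :+ b) :- b := a) refl (+ 1 / suc l) y ⟩
  + 1 / suc l                  ∎
  where
  open ℚ.≤-Reasoning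
  open ℚ-Solver.+-*-Solver
  x = invSqrtSeq (suc d) k
  y = invSqrtSeq (suc d) l
  a = root (suc d) (suc k) (suc k)
  b = root (suc d) (suc l) (suc l)
  x≤ : x ℚ.≤ + 1 / suc l ℚ.+ y
  x≤ = subst (x ℚ.≤_) (suc-/ b l) (/-mono-≤ a k (suc b) l
         (root-cross (suc d) a (suc k) (suc b) (suc l)
           (root-lower (suc d) (suc k) (suc k)) (root-upper′ d (suc l))))

archimedean : ∀ δ → 0ℚ ℚ.< δ → ∃ λ N → ∀ n → N ℕ.≤ n → + 1 / suc n ℚ.≤ δ
archimedean δ@(mkℚ (+ suc p) q c) _ = q , λ n q≤n →
  subst (+ 1 / suc n ℚ.≤_) (ℚ.fromℚᵘ-toℚᵘ δ)
    (/-mono-≤ 1 n (suc p) q (ℕ.*-mono-≤ {1} {suc p} (s≤s z≤n) (s≤s q≤n)))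
archimedean (mkℚ (+ 0) _ _) (ℚ.*<* (ℤ.+<+ ()))
archimedean (mkℚ ℤ.-[1+ _ ] _ _) (ℚ.*<* ())

∣x-y∣≤ : ∀ x y e e′ δ → x ℚ.- y ℚ.≤ e → e ℚ.≤ δ → y ℚ.- x ℚ.≤ e′ → e′ ℚ.≤ δ →
  ℚ.∣ x ℚ.- y ∣ ℚ.≤ δ
∣x-y∣≤ x y e e′ δ x-y≤e e≤δ y-x≤e′ e′≤δ =
  ∣∣≤ {x ℚ.- y} {δ} (ℚ.≤-trans {x ℚ.- y} {e} {δ} x-y≤e e≤δ)
    (subst (ℚ._≤ δ) (swap x y) (ℚ.≤-trans {y ℚ.- x} {e′} {δ} y-x≤e′ e′≤δ))
  where
  open ℚ-Solver.+-*-Solver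
  swap : ∀ x y → y ℚ.- x ≡ ℚ.- (x ℚ.- y)
  swap = solve 2 (λ x y → y :- x := :- (x :- y)) refl

invSqrt-cauchy : ∀ d → IsCauchy (invSqrtSeq (suc d))
invSqrt-cauchy d δ 0<δ =
  let N , h = archimedean δ 0<δ in N , λ m n N≤m N≤n →
    ∣x-y∣≤ (invSqrtSeq (suc d) m) (invSqrtSeq (suc d) n) (+ 1 / suc n) (+ 1 / suc m) δ
      (invSqrt-near d m n) (h n N≤n) (invSqrt-near d n m) (h m N≤m)

-- d^(-1/2), with the usual convention that it is 0 for d = 0.
invSqrt : ℕ → ℝ
invSqrt zero    = 0ᵣ
invSqrt (suc d) = mkℝ (invSqrtSeq (suc d)) (invSqrt-cauchy d)

+ᵣ-rawMonoid : RawMonoid 0ℓ 0ℓ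
+ᵣ-rawMonoid = record { _≈_ = _≈ᵣ_ ; _∙_ = _+ᵣ_ ; ε = 0ᵣ }

open RawMonoidDefs +ᵣ-rawMonoid public using () renaming (sum to sumᵣ)
open RawMonoidDefs ℕ.+-0-rawMonoid public using () renaming (sum to sumₙ)

Matrix : ℕ → Set
Matrix n = Fin n → Fin n → ℝ

identity : ∀ {n} → Matrix n
identity u v = if does (u Fin.≟ v) then 1ᵣ else 0ᵣ

infixr 7 _·ᵥ_

_·ᵥ_ : ∀ {n} → Matrix n → Vector ℝ n → Vector ℝ n
(M ·ᵥ f) u = sumᵣ λ v → M u v *ᵣ f v

IsEigenpair : ∀ {n} → Matrix n → ℝ → Vector ℝ n → Set
IsEigenpair M μ f = ∀ u → (M ·ᵥ f) u ≈ᵣ μ *ᵣ f u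

LinearlyIndependent : ∀ {n k} → (Fin k → Vector ℝ n) → Set
LinearlyIndependent {n} {k} φ = (c : Fin k → ℝ) →
  (∀ u → sumᵣ (λ i → c i *ᵣ φ i u) ≈ᵣ 0ᵣ) → ∀ i → c i ≈ᵣ 0ᵣ

-- λs 0 ≤ λs 1 ≤ … ≤ λs (n - 1) are the eigenvalues of M listed with
-- multiplicity, for a diagonalisable M (such as a symmetric one): n linearly
-- independent eigenvectors form a basis of ℝⁿ, so each eigenvalue is listed as
-- often as the dimension of its eigenspace.  Independence also makes each φ i
-- nonzero, which IsEigenpair alone does not demand.
IsSpectrum : ∀ {n} → Matrix n → Vector ℝ n → Set
IsSpectrum {n} M λs =
  (∀ i j → i Fin.≤ j → λs i ≤ᵣ λs j) ×
  (∃ λ (φ : Fin n → Vector ℝ n) →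
    (∀ i → IsEigenpair M (λs i) (φ i)) × LinearlyIndependent φ)

record SimpleGraph (n : ℕ) : Set₁ where
  infix 4 _~_ _~?_
  field
    _~_    : Rel (Fin n) 0ℓ
    _~?_   : Decidable _~_
    symm   : Symmetric _~_
    irrefl : Irreflexive _≡_ _~_

module _ {n} (G : SimpleGraph n) where
  open SimpleGraph G

  degree : Fin n → ℕ
  degree u = List.length (filter (u ~?_) (allFin n))

  vol : ℕ
  vol = sumₙ degree

  adjacency : Matrix n
  adjacency u v = if does (u ~? v) then 1ᵣ else 0ᵣ

  -- I - T^(-1/2) A T^(-1/2), where multiplying by the diagonal matrix T^(-1/2)
  -- on the left and on the right scales the rows and the columns of A.
  normalizedLaplacian : Matrix n
  normalizedLaplacian u v =
    identity u v -ᵣ invSqrt (degree u) *ᵣ adjacency u v *ᵣ invSqrt (degree v)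

  Walk : Rel (Fin n) 0ℓ
  Walk = Star _~_

  walkLength : ∀ {u v} → Walk u v → ℕ
  walkLength ε       = 0
  walkLength (_ ◅ w) = suc (walkLength w)

  Connected : Set
  Connected = ∀ u v → Walk u v

  IsDistance : Fin n → Fin n → ℕ → Set
  IsDistance u v k = (∃ λ (w : Walk u v) → walkLength w ≡ k) × (∀ (w : Walk u v) → k ℕ.≤ walkLength w)

  IsDiameter : ℕ → Set
  IsDiameter D = (∀ u v k → IsDistance u v k → k ℕ.≤ D) × (∃₂ λ u v → IsDistance u v D)

¬¬-distance : ∀ {n} (G : SimpleGraph n) {u v} b (w : Walk G u v) → walkLength G w ℕ.≤ b →
  ¬ ¬ ∃ (IsDistance G u v)
¬¬-distance G b w w≤b none = none (walkLength G w , (w , refl) , λ w′ → ℕ.≮⇒≥ λ w′<w → smaller b w′ (ℕ.<-≤-trans w′<w w≤b))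
  where
  smaller : ∀ b w′ → walkLength G w′ ℕ.< b → ⊥
  smaller (suc b) w′ (s≤s w′≤b) = ¬¬-distance G b w′ w′≤b none

diameter≢0 : ∀ {n} (G : SimpleGraph (suc (suc n))) → Connected G → ¬ IsDiameter G 0
diameter≢0 G conn (max , _) = ¬¬-distance G _ (conn zero (suc zero)) ℕ.≤-refl
  λ (k , isDist) → absurd (max zero (suc zero) k isDist) isDist
  where
  absurd : ∀ {k} → k ℕ.≤ 0 → ¬ IsDistance G zero (suc zero) k
  absurd z≤n ((_ ◅ _ , ()) , _)

vol≢0 : ∀ {n} (G : SimpleGraph (suc (suc n))) → Connected G → ¬ vol G ≡ 0
vol≢0 {n} G conn vol≡0 = neighbour (conn zero (suc zero))
  where
  open SimpleGraph G
  neighbour : ¬ Walk G zero (suc zero)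
  neighbour (_◅_ {j = v} e _) = contradiction (ℕ.m+n≡0⇒m≡0 (degree G zero) vol≡0)
    (ℕ.n>0⇒n≢0 (List.filter-some (zero ~?_) (lose (∈-allFin v) e)))

D*vol-nonZero : ∀ {n} (G : SimpleGraph n) → Connected G → 2 ℕ.≤ n →
  ∀ {D} → IsDiameter G D → NonZero (D ℕ.* vol G)
D*vol-nonZero G conn (s≤s (s≤s z≤n)) {zero} diam = contradiction diam (diameter≢0 G conn)
D*vol-nonZero G conn (s≤s (s≤s z≤n)) {suc D} diam =
  ℕ.m*n≢0 (suc D) (vol G) {{_}} {{ℕ.≢-nonZero (vol≢0 G conn)}}

{-# OPTIONS --safe #-}

-- If f = T^(-1/2) φ for an eigenpair (μ , φ), then (T - A) f = μ T f, so that
-- μ W = vol(G) E with E = Σ A(u,v) (f u - f v)² and W = Σ d(u) d(v) (f u - f v)²,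
-- both over ordered pairs.  W does not see constants, hence no orthogonality to
-- T^(1/2) 1 is needed.  Let R be max f - min f.  Popoviciu's variance bound gives
-- 2 W ≤ vol(G)² R², and Cauchy-Schwarz along a shortest walk between the extrema
-- gives 2 R² ≤ D E; so 4 W ≤ D vol(G) (vol(G) E).  If μ < 4 / (D vol(G)), this
-- forces W = 0 and f is constant.  Were λ₁ < 4 / (D vol(G)), this would hold for
-- two linearly independent eigenvectors, which is absurd.  The inequalities are
-- proved over ℚ and applied to each term of the Cauchy sequences.
module Submission where

open import Defs
import Algebra.Properties.Semiring.Sum as SemiringSum
open import Algebra.Bundles using (CommutativeRing)
open import Data.Bool.Base using (if_then_else_; true; false)
open import Data.Bool.Properties using (if-float)
open import Data.Fin.Base as Fin using (Fin; fromℕ<; zero; suc)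
import Data.Fin.Properties as Fin
open import Data.Integer.Base as ℤ using (+_)
import Data.Integer.Properties as ℤ
open import Data.List.Base using (List; []; _∷_; allFin; filter; length; tabulate)
open import Data.List.Membership.Propositional using (_∈_; lose)
open import Data.List.Membership.Propositional.Properties using (∈-allFin)
import Data.List.Properties as List
open import Data.List.Relation.Unary.All as All using (All; []; _∷_)
open import Data.List.Relation.Unary.AllPairs using ([]; _∷_)
open import Data.List.Relation.Unary.Any using (here; there)
open import Data.List.Relation.Unary.Unique.Propositional using (Unique)
open import Data.Nat.Base as ℕ using (ℕ; zero; suc; _≤_; _*_)
import Data.Nat.Properties as ℕ
open import Data.Product.Base using (∃; ∃₂; _×_; _,_; proj₁; proj₂)
open import Data.Rational.Base as ℚ using (ℚ; 0ℚ; 1ℚ; ½; _/_)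
import Data.Rational.Properties as ℚ
import Data.Rational.Solver as ℚ-Solver
open import Data.Rational.Unnormalised.Base using (mkℚᵘ; *≡*)
import Data.Rational.Unnormalised.Properties as ℚᵘ
open import Data.Sum.Base using (inj₁; inj₂)
open import Data.Vec.Functional using (Vector; updateAt)
open import Data.Vec.Functional.Properties using (updateAt-minimal)
open import Function.Base using (_∘_; const)
open import Function.Bundles using (mk⇔)
open import Relation.Binary.Bundles using (DecTotalOrder)
open import Relation.Binary.Construct.Closure.ReflexiveTransitive using (ε; _◅_)
open import Relation.Binary.PropositionalEquality
  using (_≡_; _≢_; refl; sym; trans; cong; cong₂; subst; module ≡-Reasoning)
open import Relation.Nullary using (¬_; does; yes; no; contradiction)
open import Relation.Nullary.Decidable using (decidable-stable; dec-true; does-⇔; from-no)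

open import Data.List.Extrema (DecTotalOrder.totalOrder ℚ.≤-decTotalOrder)
  using (argmax; argmin; f[xs]≤f[argmax]; f[argmin]≤f[xs])
open SemiringSum (CommutativeRing.semiring ℚ.+-*-commutativeRing) using ()
  renaming ( sum to sumℚ; sum-cong-≗ to sumℚ-cong; ∑-distrib-+ to sumℚ-distrib-+; ∑-comm to sumℚ-comm
           ; *-distribˡ-sum to *-distribˡ-sumℚ; *-distribʳ-sum to *-distribʳ-sumℚ)
open ℚ-Solver.+-*-Solver using (solve; con; _:=_; _:+_; _:*_; _:-_; :-_)

-- Rational arithmetic: squares, naturals as rationals, signs

infix 8 _²

_² : ℚ → ℚ
p ² = p ℚ.* p

ι : ℕ → ℚ
ι k = + k / 1

ι-mono : ∀ {j k} → j ≤ k → ι j ℚ.≤ ι k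
ι-mono {j} {k} j≤k = /-mono-≤ j 0 k 0 (ℕ.*-monoˡ-≤ 1 j≤k)

ι-+ : ∀ j k → ι (j ℕ.+ k) ≡ ι j ℚ.+ ι k
ι-+ zero    k = sym (ℚ.+-identityˡ (ι k))
ι-+ (suc j) k = begin
  ι (suc (j ℕ.+ k))         ≡⟨ suc-/ (j ℕ.+ k) 0 ⟩
  1ℚ ℚ.+ ι (j ℕ.+ k)        ≡⟨ cong (1ℚ ℚ.+_) (ι-+ j k) ⟩
  1ℚ ℚ.+ (ι j ℚ.+ ι k)      ≡⟨ ℚ.+-assoc 1ℚ (ι j) (ι k) ⟨
  1ℚ ℚ.+ ι j ℚ.+ ι k        ≡⟨ cong (ℚ._+ ι k) (suc-/ j 0) ⟨
  ι (suc j) ℚ.+ ι k         ∎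
  where open ≡-Reasoning

ι-* : ∀ j k → ι (j ℕ.* k) ≡ ι j ℚ.* ι k
ι-* zero    k = sym (ℚ.*-zeroˡ (ι k))
ι-* (suc j) k = begin
  ι (k ℕ.+ j ℕ.* k)               ≡⟨ ι-+ k (j ℕ.* k) ⟩
  ι k ℚ.+ ι (j ℕ.* k)             ≡⟨ cong (ι k ℚ.+_) (ι-* j k) ⟩
  ι k ℚ.+ ι j ℚ.* ι k             ≡⟨ solve 2 (λ j k → k :+ j :* k := (con 1ℚ :+ j) :* k) refl (ι j) (ι k) ⟩
  (1ℚ ℚ.+ ι j) ℚ.* ι k            ≡⟨ cong (ℚ._* ι k) (suc-/ j 0) ⟨
  ι (suc j) ℚ.* ι k               ∎
  where open ≡-Reasoning

ι-sum : ∀ {n} (d : Vector ℕ n) → ι (sumₙ d) ≡ sumℚ (λ u → ι (d u))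
ι-sum {zero}  d = refl
ι-sum {suc n} d = trans (ι-+ (d zero) (sumₙ (d ∘ suc))) (cong (ι (d zero) ℚ.+_) (ι-sum (d ∘ suc)))

0≤ι : ∀ k → 0ℚ ℚ.≤ ι k
0≤ι k = ι-mono {0} {k} ℕ.z≤n

0≤* : ∀ {p q} → 0ℚ ℚ.≤ p → 0ℚ ℚ.≤ q → 0ℚ ℚ.≤ p ℚ.* q
0≤* {p} {q} 0≤p 0≤q = ℚ.nonNegative⁻¹ (p ℚ.* q)
  {{ℚ.nonNeg*nonNeg⇒nonNeg p {{ℚ.nonNegative 0≤p}} q {{ℚ.nonNegative 0≤q}}}}

0≤p² : ∀ p → 0ℚ ℚ.≤ p ²
0≤p² p with ℚ.≤-total 0ℚ p
... | inj₁ 0≤p = 0≤* 0≤p 0≤p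
... | inj₂ p≤0 = ℚ.nonNegative⁻¹ (p ²)
  {{ℚ.nonPos*nonPos⇒nonPos p {{ℚ.nonPositive p≤0}} p {{ℚ.nonPositive p≤0}}}}

-- Reduces an inequality to a polynomial identity for the ring solver, once the gap `r` between the
-- two sides is supplied in a visibly nonnegative form.
≤-by-gap : ∀ p r {q} → 0ℚ ℚ.≤ r → p ℚ.+ r ≡ q → p ℚ.≤ q
≤-by-gap p r 0≤r refl = subst (ℚ._≤ p ℚ.+ r) (ℚ.+-identityʳ p) (ℚ.+-monoʳ-≤ p 0≤r)

p≤q⇒0≤q-p : ∀ {p q} → p ℚ.≤ q → 0ℚ ℚ.≤ q ℚ.- p
p≤q⇒0≤q-p {p} {q} p≤q = subst (ℚ._≤ q ℚ.- p) (ℚ.+-inverseʳ p) (ℚ.+-monoˡ-≤ (ℚ.- p) p≤q)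

-- Finite sums of rationals, over all indices and over lists

sumℚ-mono : ∀ {n} {f g : Vector ℚ n} → (∀ i → f i ℚ.≤ g i) → sumℚ f ℚ.≤ sumℚ g
sumℚ-mono {zero}  f≤g = ℚ.≤-refl
sumℚ-mono {suc n} f≤g = ℚ.+-mono-≤ (f≤g zero) (sumℚ-mono (f≤g ∘ suc))

sumℚ-nonneg : ∀ {n} {f : Vector ℚ n} → (∀ i → 0ℚ ℚ.≤ f i) → 0ℚ ℚ.≤ sumℚ f
sumℚ-nonneg {zero}  0≤f = ℚ.≤-refl
sumℚ-nonneg {suc n} 0≤f = ℚ.+-mono-≤ (0≤f zero) (sumℚ-nonneg (0≤f ∘ suc))

-- The entry at `i` is overwritten with 0 rather than removed, which keeps the index type `Fin n`
-- and lets entries be split off one after another.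
sumℚ-isolate : ∀ {n} (f : Vector ℚ n) i → sumℚ f ≡ f i ℚ.+ sumℚ (updateAt f i (const 0ℚ))
sumℚ-isolate f zero    = cong (f zero ℚ.+_) (sym (ℚ.+-identityˡ _))
sumℚ-isolate f (suc i) = trans (cong (f zero ℚ.+_) (sumℚ-isolate (f ∘ suc) i))
  (solve 3 (λ a b c → a :+ (b :+ c) := b :+ (a :+ c)) refl (f zero) (f (suc i)) _)

0≤updateAt-0 : ∀ {n} (f : Vector ℚ n) → (∀ j → 0ℚ ℚ.≤ f j) → ∀ i j → 0ℚ ℚ.≤ updateAt f i (const 0ℚ) j
0≤updateAt-0 f 0≤f zero    zero    = ℚ.≤-refl
0≤updateAt-0 f 0≤f zero    (suc j) = 0≤f (suc j)
0≤updateAt-0 f 0≤f (suc i) zero    = 0≤f zero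
0≤updateAt-0 f 0≤f (suc i) (suc j) = 0≤updateAt-0 (f ∘ suc) (0≤f ∘ suc) i j

term≤sumℚ : ∀ {n} (f : Vector ℚ n) → (∀ i → 0ℚ ℚ.≤ f i) → ∀ i → f i ℚ.≤ sumℚ f
term≤sumℚ f 0≤f i = ≤-by-gap (f i) _ (sumℚ-nonneg (0≤updateAt-0 f 0≤f i)) (sym (sumℚ-isolate f i))

sumOver : ∀ {A : Set} → List A → (A → ℚ) → ℚ
sumOver []       h = 0ℚ
sumOver (x ∷ xs) h = h x ℚ.+ sumOver xs h

sumOver-distrib-+ : ∀ {A : Set} xs (g h : A → ℚ) →
  sumOver xs (λ x → g x ℚ.+ h x) ≡ sumOver xs g ℚ.+ sumOver xs h
sumOver-distrib-+ []       g h = sym (ℚ.+-identityˡ 0ℚ)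
sumOver-distrib-+ (x ∷ xs) g h = trans (cong (g x ℚ.+ h x ℚ.+_) (sumOver-distrib-+ xs g h))
  (solve 4 (λ a b c d → a :+ b :+ (c :+ d) := a :+ c :+ (b :+ d)) refl (g x) (h x) _ _)

sumOver-nonneg : ∀ {A : Set} xs {h : A → ℚ} → (∀ x → 0ℚ ℚ.≤ h x) → 0ℚ ℚ.≤ sumOver xs h
sumOver-nonneg []       0≤h = ℚ.≤-refl
sumOver-nonneg (x ∷ xs) 0≤h = ℚ.+-mono-≤ (0≤h x) (sumOver-nonneg xs 0≤h)

sumOver-mono : ∀ {A : Set} xs {g h : A → ℚ} → (∀ x → g x ℚ.≤ h x) → sumOver xs g ℚ.≤ sumOver xs h
sumOver-mono []       g≤h = ℚ.≤-refl
sumOver-mono (x ∷ xs) g≤h = ℚ.+-mono-≤ (g≤h x) (sumOver-mono xs g≤h)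

sumOver-cong : ∀ {A : Set} {xs} {g h : A → ℚ} → All (λ x → g x ≡ h x) xs → sumOver xs g ≡ sumOver xs h
sumOver-cong []         = refl
sumOver-cong (eq ∷ eqs) = cong₂ ℚ._+_ eq (sumOver-cong eqs)

-- Induction on the list with `f` varying: after the head `x` is split off, `f` is set to 0 there.
-- Since `x` does not recur in the tail, the tail sum is unaffected.
unique-sumOver≤sumℚ : ∀ {n} {xs : List (Fin n)} → Unique xs →
  ∀ f → (∀ i → 0ℚ ℚ.≤ f i) → sumOver xs f ℚ.≤ sumℚ f
unique-sumOver≤sumℚ []                    f 0≤f = sumℚ-nonneg 0≤f
unique-sumOver≤sumℚ {xs = x ∷ xs} (x∉ ∷ u) f 0≤f = begin
  f x ℚ.+ sumOver xs f    ≡⟨ cong (f x ℚ.+_) (sumOver-cong (All.map (λ {y} x≢y → sym (updateAt-minimal y x f (x≢y ∘ sym))) x∉)) ⟩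
  f x ℚ.+ sumOver xs f₀   ≤⟨ ℚ.+-monoʳ-≤ (f x) (unique-sumOver≤sumℚ u f₀ (0≤updateAt-0 f 0≤f x)) ⟩
  f x ℚ.+ sumℚ f₀         ≡⟨ sumℚ-isolate f x ⟨
  sumℚ f                  ∎
  where
  open ℚ.≤-Reasoning
  f₀ = updateAt f x (const 0ℚ)

-- Dirichlet forms, the variance bound and extremal vertices

-- The sum runs over ordered pairs, so for adjacency weights it is twice the energy summed over
-- edges.
dirichlet : ∀ {n} → (Fin n → Fin n → ℚ) → Vector ℚ n → ℚ
dirichlet a f = sumℚ λ u → sumℚ λ v → a u v ℚ.* (f u ℚ.- f v) ²

sumℚ-neg : ∀ {n} (f : Vector ℚ n) → sumℚ (λ i → ℚ.- f i) ≡ ℚ.- sumℚ f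
sumℚ-neg {zero}  f = refl
sumℚ-neg {suc n} f = trans (cong (ℚ.- f zero ℚ.+_) (sumℚ-neg (f ∘ suc))) (sym (ℚ.neg-distrib-+ (f zero) _))

-- Expanding the square gives two square terms and two cross terms. Symmetry of `a` and an exchange
-- of summations identify the two square terms. The bracket on the right is the quadratic form of
-- the weighted Laplacian.
dirichlet-expand : ∀ {n} (a : Fin n → Fin n → ℚ) (f : Vector ℚ n) → (∀ u v → a u v ≡ a v u) →
  dirichlet a f ≡ ι 2 ℚ.* (sumℚ (λ u → sumℚ (a u) ℚ.* f u ²) ℚ.- sumℚ (λ u → sumℚ λ v → a u v ℚ.* (f u ℚ.* f v)))
dirichlet-expand a f a-sym = begin
  dirichlet a f
    ≡⟨ sumℚ-cong (λ u → trans (sumℚ-cong (expand u)) (split₃ (X u) (λ v → X v u) (Y u))) ⟩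
  (sumℚ λ u → sumℚ (X u) ℚ.+ (sumℚ λ v → X v u) ℚ.+ (sumℚ (Y u) ℚ.+ sumℚ (Y u)))
    ≡⟨ split₃ (λ u → sumℚ (X u)) (λ u → sumℚ λ v → X v u) (λ u → sumℚ (Y u)) ⟩
  (sumℚ λ u → sumℚ (X u)) ℚ.+ (sumℚ λ u → sumℚ λ v → X v u) ℚ.+ (sumℚ (λ u → sumℚ (Y u)) ℚ.+ sumℚ (λ u → sumℚ (Y u)))
    ≡⟨ cong₂ (λ p q → p ℚ.+ q ℚ.+ (sumℚ (λ u → sumℚ (Y u)) ℚ.+ sumℚ (λ u → sumℚ (Y u)))) diag
         (trans (sumℚ-comm (λ u v → X v u)) diag) ⟩
  N ℚ.+ N ℚ.+ (sumℚ (λ u → sumℚ (Y u)) ℚ.+ sumℚ (λ u → sumℚ (Y u)))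
    ≡⟨ cong (λ c → N ℚ.+ N ℚ.+ (c ℚ.+ c)) (trans (sumℚ-cong (λ u → sumℚ-neg (C u))) (sumℚ-neg (λ u → sumℚ (C u)))) ⟩
  N ℚ.+ N ℚ.+ (ℚ.- T ℚ.+ ℚ.- T)
    ≡⟨ solve 2 (λ N T → N :+ N :+ (:- T :+ :- T) := con (ι 2) :* (N :- T)) refl N T ⟩
  ι 2 ℚ.* (N ℚ.- T) ∎
  where
  open ≡-Reasoning
  N = sumℚ λ u → sumℚ (a u) ℚ.* f u ²
  C : Fin _ → Fin _ → ℚ
  C u v = a u v ℚ.* (f u ℚ.* f v)
  T = sumℚ λ u → sumℚ (C u)
  X Y : Fin _ → Fin _ → ℚ
  X u v = a u v ℚ.* f u ²
  Y u v = ℚ.- C u v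
  expand : ∀ u v → a u v ℚ.* (f u ℚ.- f v) ² ≡ X u v ℚ.+ X v u ℚ.+ (Y u v ℚ.+ Y u v)
  expand u v = trans
    (solve 3 (λ a x y → a :* ((x :- y) :* (x :- y))
         := a :* (x :* x) :+ a :* (y :* y) :+ (:- (a :* (x :* y)) :+ :- (a :* (x :* y)))) refl (a u v) (f u) (f v))
    (cong (λ b → X u v ℚ.+ b ℚ.* f v ² ℚ.+ (Y u v ℚ.+ Y u v)) (a-sym u v))
  split₃ : ∀ {m} (p q r : Vector ℚ m) → sumℚ (λ v → p v ℚ.+ q v ℚ.+ (r v ℚ.+ r v)) ≡ sumℚ p ℚ.+ sumℚ q ℚ.+ (sumℚ r ℚ.+ sumℚ r)
  split₃ p q r = trans (sumℚ-distrib-+ (λ v → p v ℚ.+ q v) (λ v → r v ℚ.+ r v)) (cong₂ ℚ._+_ (sumℚ-distrib-+ p q) (sumℚ-distrib-+ r r))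
  diag : (sumℚ λ u → sumℚ (X u)) ≡ N
  diag = sumℚ-cong λ u → sym (*-distribʳ-sumℚ (f u ²) (a u))

productWeights : ∀ {n} → Vector ℚ n → Fin n → Fin n → ℚ
productWeights d u v = d u ℚ.* d v

-- For product weights both double sums factor. With nonnegative weights of total V > 0, the result
-- is 2 V² times the variance of `f` under the probability weights d / V.
dirichlet-productWeights : ∀ {n} (d f : Vector ℚ n) → dirichlet (productWeights d) f ≡
  ι 2 ℚ.* (sumℚ d ℚ.* sumℚ (λ u → d u ℚ.* f u ²) ℚ.- sumℚ (λ u → d u ℚ.* f u) ²)
dirichlet-productWeights d f = trans (dirichlet-expand (productWeights d) f (λ u v → ℚ.*-comm (d u) (d v)))
  (cong₂ (λ p q → ι 2 ℚ.* (p ℚ.- q)) diag off)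
  where
  V = sumℚ d
  S = sumℚ λ u → d u ℚ.* f u
  diag : (sumℚ λ u → sumℚ (productWeights d u) ℚ.* f u ²) ≡ V ℚ.* sumℚ (λ u → d u ℚ.* f u ²)
  diag = trans (sumℚ-cong λ u → trans (cong (ℚ._* f u ²) (sym (*-distribˡ-sumℚ (d u) d)))
                 (solve 3 (λ a b c → a :* b :* c := b :* (a :* c)) refl (d u) V (f u ²)))
    (sym (*-distribˡ-sumℚ V λ u → d u ℚ.* f u ²))
  off : (sumℚ λ u → sumℚ λ v → d u ℚ.* d v ℚ.* (f u ℚ.* f v)) ≡ S ²
  off = trans (sumℚ-cong λ u → trans
      (sumℚ-cong λ v → solve 4 (λ a b c e → a :* b :* (c :* e) := a :* c :* (b :* e)) refl (d u) (d v) (f u) (f v))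
      (sym (*-distribˡ-sumℚ (d u ℚ.* f u) λ v → d v ℚ.* f v)))
    (sym (*-distribʳ-sumℚ S λ u → d u ℚ.* f u))

-- The gap is exactly 4 V Σ d (f - m) (M - f) + (2 S - V (M + m))². The first term is nonnegative
-- because `f` stays between `m` and `M`, the second because it is a square.
popoviciu : ∀ {n} (d f : Vector ℚ n) m M → (∀ u → 0ℚ ℚ.≤ d u) → (∀ u → m ℚ.≤ f u) → (∀ u → f u ℚ.≤ M) →
  ι 2 ℚ.* dirichlet (productWeights d) f ℚ.≤ sumℚ d ² ℚ.* (M ℚ.- m) ²
popoviciu d f m M 0≤d m≤f f≤M = ≤-by-gap _ _ 0≤gap (begin
  ι 2 ℚ.* dirichlet (productWeights d) f ℚ.+ (ι 4 ℚ.* V ℚ.* P ℚ.+ (ι 2 ℚ.* S ℚ.- V ℚ.* (M ℚ.+ m)) ²)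
    ≡⟨ cong₂ (λ w p → ι 2 ℚ.* w ℚ.+ (ι 4 ℚ.* V ℚ.* p ℚ.+ (ι 2 ℚ.* S ℚ.- V ℚ.* (M ℚ.+ m)) ²)) (dirichlet-productWeights d f) P≡ ⟩
  ι 2 ℚ.* (ι 2 ℚ.* (V ℚ.* N ℚ.- S ²)) ℚ.+ (ι 4 ℚ.* V ℚ.* ((M ℚ.+ m) ℚ.* S ℚ.+ (ℚ.- (m ℚ.* M) ℚ.* V ℚ.+ ℚ.- N)) ℚ.+ (ι 2 ℚ.* S ℚ.- V ℚ.* (M ℚ.+ m)) ²)
    ≡⟨ solve 5 (λ V N S M m →
         con (ι 2) :* (con (ι 2) :* (V :* N :- S :* S)) :+ (con (ι 4) :* V :* ((M :+ m) :* S :+ (:- (m :* M) :* V :+ :- N)) :+ (con (ι 2) :* S :- V :* (M :+ m)) :* (con (ι 2) :* S :- V :* (M :+ m)))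
         := V :* V :* ((M :- m) :* (M :- m))) refl V N S M m ⟩
  V ² ℚ.* (M ℚ.- m) ² ∎)
  where
  open ≡-Reasoning
  V = sumℚ d
  N = sumℚ λ u → d u ℚ.* f u ²
  S = sumℚ λ u → d u ℚ.* f u
  P = sumℚ λ u → d u ℚ.* ((f u ℚ.- m) ℚ.* (M ℚ.- f u))
  P≡ : P ≡ (M ℚ.+ m) ℚ.* S ℚ.+ (ℚ.- (m ℚ.* M) ℚ.* V ℚ.+ ℚ.- N)
  P≡ = begin
    P
      ≡⟨ sumℚ-cong (λ u → solve 4 (λ d f m M → d :* ((f :- m) :* (M :- f))
           := (M :+ m) :* (d :* f) :+ (:- (m :* M) :* d :+ :- (d :* (f :* f)))) refl (d u) (f u) m M) ⟩
    sumℚ (λ u → (M ℚ.+ m) ℚ.* (d u ℚ.* f u) ℚ.+ (ℚ.- (m ℚ.* M) ℚ.* d u ℚ.+ ℚ.- (d u ℚ.* f u ²)))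
      ≡⟨ trans (sumℚ-distrib-+ (λ u → (M ℚ.+ m) ℚ.* (d u ℚ.* f u)) _)
           (cong (sumℚ (λ u → (M ℚ.+ m) ℚ.* (d u ℚ.* f u)) ℚ.+_) (sumℚ-distrib-+ (λ u → ℚ.- (m ℚ.* M) ℚ.* d u) _)) ⟩
    sumℚ (λ u → (M ℚ.+ m) ℚ.* (d u ℚ.* f u)) ℚ.+ (sumℚ (λ u → ℚ.- (m ℚ.* M) ℚ.* d u) ℚ.+ sumℚ (λ u → ℚ.- (d u ℚ.* f u ²)))
      ≡⟨ cong₂ ℚ._+_ (sym (*-distribˡ-sumℚ (M ℚ.+ m) λ u → d u ℚ.* f u))
           (cong₂ ℚ._+_ (sym (*-distribˡ-sumℚ (ℚ.- (m ℚ.* M)) d)) (sumℚ-neg λ u → d u ℚ.* f u ²)) ⟩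
    (M ℚ.+ m) ℚ.* S ℚ.+ (ℚ.- (m ℚ.* M) ℚ.* V ℚ.+ ℚ.- N) ∎
  0≤P : 0ℚ ℚ.≤ P
  0≤P = sumℚ-nonneg λ u → 0≤* (0≤d u) (0≤* (p≤q⇒0≤q-p (m≤f u)) (p≤q⇒0≤q-p (f≤M u)))
  0≤gap : 0ℚ ℚ.≤ ι 4 ℚ.* V ℚ.* P ℚ.+ (ι 2 ℚ.* S ℚ.- V ℚ.* (M ℚ.+ m)) ²
  0≤gap = ℚ.+-mono-≤ (0≤* (0≤* (0≤ι 4) (sumℚ-nonneg 0≤d)) 0≤P) (0≤p² (ι 2 ℚ.* S ℚ.- V ℚ.* (M ℚ.+ m)))

extrema : ∀ {n} (f : Vector ℚ (suc n)) → ∃₂ λ p q → (∀ u → f q ℚ.≤ f u) × (∀ u → f u ℚ.≤ f p)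
extrema f = argmax f zero (allFin _) , argmin f zero (allFin _) ,
  (λ u → All.lookup (f[argmin]≤f[xs] {f = f} zero (allFin _)) (∈-allFin u)) ,
  (λ u → All.lookup (f[xs]≤f[argmax] {f = f} zero (allFin _)) (∈-allFin u))

-- Shortest walks and their energy

adjacencyℚ : ∀ {n} (G : SimpleGraph n) → Fin n → Fin n → ℚ
adjacencyℚ G u v = if does (SimpleGraph._~?_ G u v) then 1ℚ else 0ℚ

module _ {n} (G : SimpleGraph n) where
  open SimpleGraph G

  private
    a : Fin n → Fin n → ℚ
    a = adjacencyℚ G

  adjacencyℚ-edge : ∀ {u v} → u ~ v → a u v ≡ 1ℚ
  adjacencyℚ-edge {u} {v} e = cong (if_then 1ℚ else 0ℚ) (dec-true (u ~? v) e)

  adjacencyℚ-sym : ∀ u v → a u v ≡ a v u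
  adjacencyℚ-sym u v = cong (if_then 1ℚ else 0ℚ) (does-⇔ (mk⇔ symm symm) (u ~? v) (v ~? u))

  0≤adjacencyℚ : ∀ u v → 0ℚ ℚ.≤ a u v
  0≤adjacencyℚ u v with does (u ~? v)
  ... | true  = ℚ.nonNegative⁻¹ 1ℚ
  ... | false = ℚ.≤-refl

  -- Stated for `tabulate g` instead of `allFin n`, so that the induction can pass from `g` to
  -- `g ∘ suc`.
  ι-length-filter : ∀ {m} u (g : Fin m → Fin n) → ι (length (filter (u ~?_) (tabulate g))) ≡ sumℚ (λ i → a u (g i))
  ι-length-filter {zero}  u g = refl
  ι-length-filter {suc m} u g with does (u ~? g zero)
  ... | true  = trans (suc-/ (length (filter (u ~?_) (tabulate (g ∘ suc)))) 0) (cong (1ℚ ℚ.+_) (ι-length-filter u (g ∘ suc)))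
  ... | false = trans (ι-length-filter u (g ∘ suc)) (sym (ℚ.+-identityˡ _))

  ι-degree : ∀ u → ι (degree G u) ≡ sumℚ (a u)
  ι-degree u = ι-length-filter u (λ v → v)

  vertices : ∀ {u v} → Walk G u v → List (Fin n)
  vertices {u} ε       = u ∷ []
  vertices {u} (_ ◅ w) = u ∷ vertices w

  shortcut : ∀ {u v x} (w : Walk G u v) → x ∈ vertices w →
    ∃ λ (w′ : Walk G x v) → walkLength G w′ ≤ walkLength G w
  shortcut ε       (here refl) = ε , ℕ.z≤n
  shortcut (e ◅ w) (here refl) = e ◅ w , ℕ.≤-refl
  shortcut (e ◅ w) (there x∈)  with w′ , w′≤w ← shortcut w x∈ = w′ , ℕ.m≤n⇒m≤1+n w′≤w

  -- If the first vertex recurred later, `shortcut` from the recurrence would give a strictly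
  -- shorter walk. Tails of shortest walks are shortest, so the argument repeats.
  shortest⇒unique : ∀ {u v} (w : Walk G u v) → (∀ (w′ : Walk G u v) → walkLength G w ≤ walkLength G w′) →
    Unique (vertices w)
  shortest⇒unique ε       _        = [] ∷ []
  shortest⇒unique (e ◅ w) shortest =
    All.tabulate (λ { x∈ refl → let w′ , w′≤w = shortcut w x∈ in ℕ.<⇒≱ (ℕ.s≤s w′≤w) (shortest w′) }) ∷
    shortest⇒unique w (λ w′ → ℕ.s≤s⁻¹ (shortest (e ◅ w′)))

  module _ (f : Vector ℚ n) where

    walkEnergy : ∀ {u v} → Walk G u v → ℚ
    walkEnergy ε                   = 0ℚ
    walkEnergy {u} (_◅_ {j = v} _ w) = (f u ℚ.- f v) ² ℚ.+ walkEnergy w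

    -- Each step contributes (D Δ - c)² ≥ 0, where Δ is the drop of f along it.
    walk-cauchy-schwarz : ∀ D c {u v} (w : Walk G u v) →
      ι 2 ℚ.* D ℚ.* c ℚ.* (f u ℚ.- f v) ℚ.≤ D ² ℚ.* walkEnergy w ℚ.+ ι (walkLength G w) ℚ.* c ²
    walk-cauchy-schwarz D c {u} ε = ℚ.≤-reflexive
      (solve 3 (λ D c x → con (ι 2) :* D :* c :* (x :- x) := D :* D :* con 0ℚ :+ con 0ℚ :* (c :* c)) refl D c (f u))
    walk-cauchy-schwarz D c {u} {v} (_◅_ {j = j} e w) = begin
      ι 2 ℚ.* D ℚ.* c ℚ.* (f u ℚ.- f v)
        ≤⟨ ≤-by-gap _ ((D ℚ.* (f u ℚ.- f j) ℚ.- c) ²) (0≤p² (D ℚ.* (f u ℚ.- f j) ℚ.- c))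
             (solve 5 (λ D c x y z → con (ι 2) :* D :* c :* (x :- z) :+ (D :* (x :- y) :- c) :* (D :* (x :- y) :- c)
               := D :* D :* ((x :- y) :* (x :- y)) :+ c :* c :+ con (ι 2) :* D :* c :* (y :- z)) refl D c (f u) (f j) (f v)) ⟩
      D ² ℚ.* (f u ℚ.- f j) ² ℚ.+ c ² ℚ.+ ι 2 ℚ.* D ℚ.* c ℚ.* (f j ℚ.- f v)
        ≤⟨ ℚ.+-monoʳ-≤ (D ² ℚ.* (f u ℚ.- f j) ² ℚ.+ c ²) (walk-cauchy-schwarz D c w) ⟩
      D ² ℚ.* (f u ℚ.- f j) ² ℚ.+ c ² ℚ.+ (D ² ℚ.* walkEnergy w ℚ.+ ι (walkLength G w) ℚ.* c ²)
        ≡⟨ solve 5 (λ D c x q k → D :* D :* x :+ c :* c :+ (D :* D :* q :+ k :* (c :* c))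
             := D :* D :* (x :+ q) :+ (con 1ℚ :+ k) :* (c :* c)) refl D c ((f u ℚ.- f j) ²) (walkEnergy w) (ι (walkLength G w)) ⟩
      D ² ℚ.* ((f u ℚ.- f j) ² ℚ.+ walkEnergy w) ℚ.+ (1ℚ ℚ.+ ι (walkLength G w)) ℚ.* c ²
        ≡⟨ cong (λ k → D ² ℚ.* ((f u ℚ.- f j) ² ℚ.+ walkEnergy w) ℚ.+ k ℚ.* c ²) (suc-/ (walkLength G w) 0) ⟨
      D ² ℚ.* ((f u ℚ.- f j) ² ℚ.+ walkEnergy w) ℚ.+ ι (suc (walkLength G w)) ℚ.* c ² ∎
      where open ℚ.≤-Reasoning

    private
      g : Fin n → Fin n → ℚ
      g u v = a u v ℚ.* (f u ℚ.- f v) ²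

      0≤g : ∀ u v → 0ℚ ℚ.≤ g u v
      0≤g u v = 0≤* (0≤adjacencyℚ u v) (0≤p² (f u ℚ.- f v))

      g-sym : ∀ u v → g u v ≡ g v u
      g-sym u v = cong₂ ℚ._*_ (adjacencyℚ-sym u v) (solve 2 (λ x y → (x :- y) :* (x :- y)
           := (y :- x) :* (y :- x)) refl (f u) (f v))

      g-edge : ∀ {u v} → u ~ v → (f u ℚ.- f v) ² ≡ g u v
      g-edge {u} {v} e = trans (sym (ℚ.*-identityˡ _)) (cong (ℚ._* (f u ℚ.- f v) ²) (sym (adjacencyℚ-edge e)))

      start≤sumOver : ∀ {u v} (w : Walk G u v) {h} → (∀ x → 0ℚ ℚ.≤ h x) → h u ℚ.≤ sumOver (vertices w) h
      start≤sumOver {u} ε       {h} 0≤h = ≤-by-gap (h u) 0ℚ ℚ.≤-refl refl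
      start≤sumOver {u} (_ ◅ w) {h} 0≤h = ≤-by-gap (h u) _ (sumOver-nonneg (vertices w) 0≤h) refl

    -- The factor 2 comes from the two orders of each edge. When the head `u` is added, its step to
    -- `j` is found once in the new row, as the pair (u, j), and once in the new column, as (j, u);
    -- the other new entries are nonnegative.
    walkEnergy≤sumOver² : ∀ {u v} (w : Walk G u v) →
      ι 2 ℚ.* walkEnergy w ℚ.≤ sumOver (vertices w) (λ x → sumOver (vertices w) (g x))
    walkEnergy≤sumOver² {u} ε = subst (ℚ._≤ sumOver (u ∷ []) λ x → sumOver (u ∷ []) (g x)) (sym (ℚ.*-zeroʳ (ι 2)))
      (sumOver-nonneg (u ∷ []) λ x → sumOver-nonneg (u ∷ []) (0≤g x))
    walkEnergy≤sumOver² {u} (_◅_ {j = j} e w) = begin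
      ι 2 ℚ.* ((f u ℚ.- f j) ² ℚ.+ walkEnergy w)
        ≡⟨ solve 2 (λ x q → con (ι 2) :* (x :+ q)
             := con 0ℚ :+ x :+ (x :+ con (ι 2) :* q)) refl ((f u ℚ.- f j) ²) (walkEnergy w) ⟩
      0ℚ ℚ.+ (f u ℚ.- f j) ² ℚ.+ ((f u ℚ.- f j) ² ℚ.+ ι 2 ℚ.* walkEnergy w)
        ≤⟨ ℚ.+-mono-≤ (ℚ.+-mono-≤ (0≤g u u) row) (ℚ.+-mono-≤ column (walkEnergy≤sumOver² w)) ⟩
      g u u ℚ.+ sumOver L (g u) ℚ.+ (sumOver L (λ x → g x u) ℚ.+ sumOver L (λ x → sumOver L (g x)))
        ≡⟨ cong (g u u ℚ.+ sumOver L (g u) ℚ.+_) (sumOver-distrib-+ L (λ x → g x u) (λ x → sumOver L (g x))) ⟨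
      g u u ℚ.+ sumOver L (g u) ℚ.+ sumOver L (λ x → g x u ℚ.+ sumOver L (g x)) ∎
      where
      open ℚ.≤-Reasoning
      L = vertices w
      row : (f u ℚ.- f j) ² ℚ.≤ sumOver L (g u)
      row = subst (ℚ._≤ sumOver L (g u)) (sym (g-edge e)) (start≤sumOver w (0≤g u))
      column : (f u ℚ.- f j) ² ℚ.≤ sumOver L (λ x → g x u)
      column = subst (ℚ._≤ sumOver L (λ x → g x u)) (trans (g-sym j u) (sym (g-edge e))) (start≤sumOver w (λ x → 0≤g x u))

    -- As the vertices of the walk are distinct, the double sum over them is part of the double sum
    -- over all vertices; `unique-sumOver≤sumℚ` is applied to each row and then to the row sums.
    walkEnergy≤dirichlet : ∀ {u v} (w : Walk G u v) → Unique (vertices w) → ι 2 ℚ.* walkEnergy w ℚ.≤ dirichlet a f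
    walkEnergy≤dirichlet w unique = begin
      ι 2 ℚ.* walkEnergy w
        ≤⟨ walkEnergy≤sumOver² w ⟩
      sumOver (vertices w) (λ x → sumOver (vertices w) (g x))
        ≤⟨ sumOver-mono (vertices w) (λ x → unique-sumOver≤sumℚ unique (g x) (0≤g x)) ⟩
      sumOver (vertices w) (λ x → sumℚ (g x))
        ≤⟨ unique-sumOver≤sumℚ unique (λ x → sumℚ (g x)) (λ x → sumℚ-nonneg (0≤g x)) ⟩
      dirichlet a f ∎
      where open ℚ.≤-Reasoning

    oscillation≤dirichlet : Connected G → ∀ {D} .{{_ : ℕ.NonZero D}} → IsDiameter G D → ∀ u v →
      ι 2 ℚ.* (f u ℚ.- f v) ² ℚ.≤ ι D ℚ.* dirichlet a f
    -- A shortest walk is available only up to double negation. This suffices, because the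
    -- inequality to be proved is between rationals and hence decidable.
    oscillation≤dirichlet conn {D} diam u v = decidable-stable (_ ℚ.≤? _) λ ¬goal →
      ¬¬-distance G _ (conn u v) ℕ.≤-refl λ (k , isDist) → ¬goal (bound k isDist)
      where
      open ℚ.≤-Reasoning
      Dℚ = ι D
      -- With this `c`, `walk-cauchy-schwarz` reads 2 D c² ≤ D² Q + k c², and k ≤ D leaves D c² ≤ D²
      -- Q. Doubling this and cancelling one factor D gives 2 c² ≤ D (2 Q).
      c = f u ℚ.- f v
      bound : ∀ k → IsDistance G u v k → ι 2 ℚ.* c ² ℚ.≤ Dℚ ℚ.* dirichlet a f
      bound k isDist@((w , refl) , shortest) = ℚ.≤-trans {ι 2 ℚ.* c ²} {Dℚ ℚ.* (ι 2 ℚ.* Q)} {Dℚ ℚ.* dirichlet a f}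
        (ℚ.*-cancelˡ-≤-pos Dℚ {{D-pos}} (begin
          Dℚ ℚ.* (ι 2 ℚ.* c ²)
            ≡⟨ solve 2 (λ D c → D :* (con (ι 2) :* (c :* c))
                 := con (ι 2) :* (con (ι 2) :* D :* c :* c) :- con (ι 2) :* (D :* (c :* c))) refl Dℚ c ⟩
          ι 2 ℚ.* (ι 2 ℚ.* Dℚ ℚ.* c ℚ.* c) ℚ.- ι 2 ℚ.* (Dℚ ℚ.* c ²)
            ≤⟨ ℚ.+-monoˡ-≤ (ℚ.- (ι 2 ℚ.* (Dℚ ℚ.* c ²))) (ℚ.*-monoˡ-≤-nonNeg (ι 2) (walk-cauchy-schwarz Dℚ c w)) ⟩
          ι 2 ℚ.* (Dℚ ² ℚ.* Q ℚ.+ ι k ℚ.* c ²) ℚ.- ι 2 ℚ.* (Dℚ ℚ.* c ²)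
            ≤⟨ ℚ.+-monoˡ-≤ (ℚ.- (ι 2 ℚ.* (Dℚ ℚ.* c ²))) (ℚ.*-monoˡ-≤-nonNeg (ι 2) (ℚ.+-monoʳ-≤ (Dℚ ² ℚ.* Q)
                 (ℚ.*-monoʳ-≤-nonNeg (c ²) {{ℚ.nonNegative (0≤p² c)}} (ι-mono (proj₁ diam u v k isDist))))) ⟩
          ι 2 ℚ.* (Dℚ ² ℚ.* Q ℚ.+ Dℚ ℚ.* c ²) ℚ.- ι 2 ℚ.* (Dℚ ℚ.* c ²)
            ≡⟨ solve 3 (λ D Q c → con (ι 2) :* (D :* D :* Q :+ D :* (c :* c)) :- con (ι 2) :* (D :* (c :* c))
                 := D :* (D :* (con (ι 2) :* Q))) refl Dℚ Q c ⟩
          Dℚ ℚ.* (Dℚ ℚ.* (ι 2 ℚ.* Q)) ∎))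
        (ℚ.*-monoˡ-≤-nonNeg Dℚ {{ℚ.nonNegative (0≤ι D)}} (walkEnergy≤dirichlet w (shortest⇒unique w shortest)))
        where
        Q = walkEnergy w
        D-pos : ℚ.Positive Dℚ
        D-pos = ℚ.normalize-pos D 1

-- The Poincaré inequality

-- `popoviciu` bounds the left side by the oscillation between two extremal vertices, and
-- `oscillation≤dirichlet` at that pair bounds the oscillation by the energy. Each contributes a
-- factor 2 to the 4.
poincaré : ∀ {n} (G : SimpleGraph n) → Connected G → ∀ {D} .{{_ : ℕ.NonZero D}} → IsDiameter G D →
  (f : Vector ℚ n) → let d = ι ∘ degree G in
  ι 4 ℚ.* dirichlet (productWeights d) f ℚ.≤ ι D ℚ.* ι (vol G) ℚ.* (ι (vol G) ℚ.* dirichlet (adjacencyℚ G) f)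
-- The empty graph has no extremal vertices; here both sides are 0.
poincaré {zero}  G conn {D} diam f = ℚ.≤-reflexive
  (solve 1 (λ D → con (ι 4) :* con 0ℚ := D :* con 0ℚ :* (con 0ℚ :* con 0ℚ)) refl (ι D))
poincaré {suc n} G conn {D} diam f = begin
  ι 4 ℚ.* W                           ≡⟨ solve 1 (λ W → con (ι 4) :* W := con (ι 2) :* (con (ι 2) :* W)) refl W ⟩
  ι 2 ℚ.* (ι 2 ℚ.* W)                 ≤⟨ ℚ.*-monoˡ-≤-nonNeg (ι 2) (popoviciu d f (f q) (f p) (λ u → 0≤ι (degree G u)) lower upper) ⟩
  ι 2 ℚ.* (sumℚ d ² ℚ.* R ²)          ≡⟨ cong (λ V → ι 2 ℚ.* (V ² ℚ.* R ²)) (ι-sum (degree G)) ⟨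
  ι 2 ℚ.* (V ² ℚ.* R ²)               ≡⟨ solve 2 (λ V R → con (ι 2) :* (V :* R)
       := V :* (con (ι 2) :* R)) refl (V ²) (R ²) ⟩
  V ² ℚ.* (ι 2 ℚ.* R ²)               ≤⟨ ℚ.*-monoˡ-≤-nonNeg (V ²) {{ℚ.nonNegative (0≤p² V)}} (oscillation≤dirichlet G f conn diam p q) ⟩
  V ² ℚ.* (ι D ℚ.* E)                 ≡⟨ solve 3 (λ V D E → V :* V :* (D :* E) := D :* V :* (V :* E)) refl V (ι D) E ⟩
  ι D ℚ.* V ℚ.* (V ℚ.* E)             ∎
  where
  open ℚ.≤-Reasoning
  d = ι ∘ degree G
  V = ι (vol G)
  W = dirichlet (productWeights d) f
  E = dirichlet (adjacencyℚ G) f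
  extremal = extrema f
  p = proj₁ extremal
  q = proj₁ (proj₂ extremal)
  lower = proj₁ (proj₂ (proj₂ extremal))
  upper = proj₂ (proj₂ (proj₂ extremal))
  R = f p ℚ.- f q

-- Fractions, squares and absolute values

a/d*d≡a : ∀ a d .{{_ : ℕ.NonZero d}} → (+ a / d) ℚ.* ι d ≡ ι a
a/d*d≡a a (suc k) = ℚ.toℚᵘ-injective
  (ℚᵘ.≃-trans (ℚ.toℚᵘ-homo-* (+ a / suc k) (ι (suc k)))
  (ℚᵘ.≃-trans (ℚᵘ.*-cong (ℚ.toℚᵘ-fromℚᵘ (mkℚᵘ (+ a) k)) (ℚ.toℚᵘ-fromℚᵘ (mkℚᵘ (+ suc k) 0)))
  (ℚᵘ.≃-trans (*≡* eq) (ℚᵘ.≃-sym (ℚ.toℚᵘ-fromℚᵘ (mkℚᵘ (+ a) 0))))))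
  where
  eq : (+ a ℤ.* + suc k) ℤ.* + 1 ≡ + a ℤ.* + (suc k ℕ.* 1)
  eq = trans (ℤ.*-assoc (+ a) (+ suc k) (+ 1)) (cong (+ a ℤ.*_) (sym (ℤ.pos-* (suc k) 1)))

1≤ι : ∀ d .{{_ : ℕ.NonZero d}} → 1ℚ ℚ.≤ ι d
1≤ι (suc d) = ι-mono {1} {suc d} (ℕ.s≤s ℕ.z≤n)

square-cancel-≤ : ∀ {p q} → 0ℚ ℚ.< q → p ² ℚ.≤ q ² → p ℚ.≤ q
square-cancel-≤ {p} {q} 0<q p²≤q² = ℚ.≮⇒≥ λ q<p → ℚ.<-irrefl refl (begin-strict
  q ²       <⟨ ℚ.*-monoʳ-<-pos q {{ℚ.positive 0<q}} q<p ⟩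
  q ℚ.* p   ≤⟨ ℚ.*-monoʳ-≤-nonNeg p {{ℚ.nonNegative (ℚ.<⇒≤ (ℚ.<-trans 0<q q<p))}} (ℚ.<⇒≤ q<p) ⟩
  p ²       ≤⟨ p²≤q² ⟩
  q ²       ∎)
  where open ℚ.≤-Reasoning

square≤⇒∣∣≤ : ∀ {p q} → 0ℚ ℚ.< q → p ² ℚ.≤ q ² → ℚ.∣ p ∣ ℚ.≤ q
square≤⇒∣∣≤ {p} {q} 0<q p²≤q² = ∣∣≤ (square-cancel-≤ 0<q p²≤q²)
  (square-cancel-≤ 0<q (subst (ℚ._≤ q ²) (solve 1 (λ p → p :* p := :- p :* :- p) refl p) p²≤q²))

p≤∣p∣ : ∀ p → p ℚ.≤ ℚ.∣ p ∣
p≤∣p∣ p with ℚ.≤-total 0ℚ p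
... | inj₁ 0≤p = ℚ.≤-reflexive (sym (ℚ.0≤p⇒∣p∣≡p 0≤p))
... | inj₂ p≤0 = ℚ.≤-trans p≤0 (ℚ.0≤∣p∣ p)

-- Null sequences

-- Convergence to 0 for bare sequences, so that rational identities can be applied index by index
-- without carrying Cauchy proofs along.
Null : (ℕ → ℚ) → Set
Null x = ∀ δ → 0ℚ ℚ.< δ → ∃ λ N → ∀ n → N ≤ n → ℚ.∣ x n ∣ ℚ.≤ δ

null-cong : ∀ {x y} → (∀ n → x n ≡ y n) → Null x → Null y
null-cong x≡y x-null δ 0<δ with N , h ← x-null δ 0<δ =
  N , λ n N≤n → subst (λ p → ℚ.∣ p ∣ ℚ.≤ δ) (x≡y n) (h n N≤n)

null-0 : Null (λ _ → 0ℚ)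
null-0 δ 0<δ = 0 , λ _ _ → ℚ.<⇒≤ 0<δ

null-+ : ∀ {x y} → Null x → Null y → Null (λ n → x n ℚ.+ y n)
null-+ {x} {y} x-null y-null δ 0<δ
  with N₁ , h₁ ← x-null (½ ℚ.* δ) (½*pos 0<δ)
     | N₂ , h₂ ← y-null (½ ℚ.* δ) (½*pos 0<δ) = N₁ ℕ.⊔ N₂ , λ n N≤n → begin
  ℚ.∣ x n ℚ.+ y n ∣             ≤⟨ ℚ.∣p+q∣≤∣p∣+∣q∣ (x n) (y n) ⟩
  ℚ.∣ x n ∣ ℚ.+ ℚ.∣ y n ∣       ≤⟨ ℚ.+-mono-≤ (h₁ n (ℕ.m⊔n≤o⇒m≤o N₁ N₂ N≤n)) (h₂ n (ℕ.m⊔n≤o⇒n≤o N₁ N₂ N≤n)) ⟩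
  ½ ℚ.* δ ℚ.+ ½ ℚ.* δ           ≡⟨ ½+½ δ ⟩
  δ                             ∎
  where open ℚ.≤-Reasoning

-- The first factor is a real and not just a sequence: its Cauchy property makes it eventually
-- bounded, and the bound sets the tolerance demanded of `y`.
null-* : ∀ (x : ℝ) {y} → Null y → Null (λ n → seq x n ℚ.* y n)
null-* x {y} y-null δ 0<δ =
  let N₁ , B , 0≤B , x≤B = eventually-bounded x
      η , 0<η , Bη≤δ = shrink B δ 0≤B 0<δ
      N₂ , y≤η = y-null η 0<η
  in N₁ ℕ.⊔ N₂ , λ n N≤n →
    subst (ℚ._≤ δ) (sym (ℚ.∣p*q∣≡∣p∣*∣q∣ (seq x n) (y n)))
      (ℚ.≤-trans {ℚ.∣ seq x n ∣ ℚ.* ℚ.∣ y n ∣} {B ℚ.* η} {δ}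
        (*-mono-≤-0≤ {ℚ.∣ seq x n ∣} {B} {ℚ.∣ y n ∣} {η} 0≤∣ y n ∣ 0≤B
          (x≤B n (ℕ.m⊔n≤o⇒m≤o N₁ N₂ N≤n)) (y≤η n (ℕ.m⊔n≤o⇒n≤o N₁ N₂ N≤n)))
        Bη≤δ)

null-sum : ∀ {m} {x : Fin m → ℕ → ℚ} → (∀ i → Null (x i)) → Null (λ n → sumℚ (λ i → x i n))
null-sum {zero}  null = null-0
null-sum {suc m} null = null-+ (null zero) (null-sum (null ∘ suc))

null⇒≈ᵣ0 : ∀ x → Null (seq x) → x ≈ᵣ 0ᵣ
null⇒≈ᵣ0 x = null-cong (λ n → sym (ℚ.+-identityʳ (seq x n)))

≈ᵣ0⇒null : ∀ x → x ≈ᵣ 0ᵣ → Null (seq x)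
≈ᵣ0⇒null x = null-cong (λ n → ℚ.+-identityʳ (seq x n))

seq-sumᵣ : ∀ {m} (x : Vector ℝ m) n → seq (sumᵣ x) n ≡ sumℚ (λ i → seq (x i) n)
seq-sumᵣ {zero}  x n = refl
seq-sumᵣ {suc m} x n = cong (seq (x zero) n ℚ.+_) (seq-sumᵣ (x ∘ suc) n)

-- Strict order on the reals

infix 4 _<ᵣ_

-- The strict inequality carries a rational gap valid for all large indices, by which the later
-- estimates divide.
_<ᵣ_ : ℝ → ℝ → Set
x <ᵣ y = ∃ λ γ → 0ℚ ℚ.< γ × ∃ λ N → ∀ n → N ≤ n → seq x n ℚ.+ γ ℚ.≤ seq y n

≤ᵣ-<ᵣ-trans : ∀ x y z → x ≤ᵣ y → y <ᵣ z → x <ᵣ z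
≤ᵣ-<ᵣ-trans x y z x≤y (γ , 0<γ , N₁ , h₁) with N₂ , h₂ ← x≤y (½ ℚ.* γ) (½*pos 0<γ) =
  ½ ℚ.* γ , ½*pos 0<γ , N₁ ℕ.⊔ N₂ , λ n N≤n → begin
  seq x n ℚ.+ ½ ℚ.* γ                  ≤⟨ ℚ.+-monoˡ-≤ (½ ℚ.* γ) (h₂ n (ℕ.m⊔n≤o⇒n≤o N₁ N₂ N≤n)) ⟩
  seq y n ℚ.+ ½ ℚ.* γ ℚ.+ ½ ℚ.* γ      ≡⟨ trans (ℚ.+-assoc (seq y n) (½ ℚ.* γ) (½ ℚ.* γ)) (cong (seq y n ℚ.+_) (½+½ γ)) ⟩
  seq y n ℚ.+ γ                        ≤⟨ h₁ n (ℕ.m⊔n≤o⇒m≤o N₁ N₂ N≤n) ⟩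
  seq z n                              ∎
  where open ℚ.≤-Reasoning

-- With the difference y - x known up to δ/4 =: η, either it is at most 2 η at
-- the reference index, hence at most 3 η later on, or it stays above η.
≮ᵣ⇒≥ᵣ : ∀ x y → ¬ x <ᵣ y → x ≥ᵣ y
≮ᵣ⇒≥ᵣ x y x≮y δ 0<δ = N , bound
  where
  open ℚ.≤-Reasoning
  η = ½ ℚ.* (½ ℚ.* δ)
  0<η : 0ℚ ℚ.< η
  0<η = ½*pos (½*pos 0<δ)
  z = y -ᵣ x
  N = proj₁ (cauchy z η 0<η)
  near = proj₂ (cauchy z η 0<η)
  z-step : ∀ m n → N ≤ m → N ≤ n → seq z m ℚ.≤ η ℚ.+ seq z n
  z-step m n N≤m N≤n = begin
    seq z m                               ≡⟨ solve 2 (λ a b → a := a :- b :+ b) refl (seq z m) (seq z n) ⟩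
    seq z m ℚ.- seq z n ℚ.+ seq z n       ≤⟨ ℚ.+-monoˡ-≤ (seq z n) (ℚ.≤-trans (p≤∣p∣ (seq z m ℚ.- seq z n)) (near m n N≤m N≤n)) ⟩
    η ℚ.+ seq z n                         ∎
  bound : ∀ n → N ≤ n → seq y n ℚ.≤ seq x n ℚ.+ δ
  bound n N≤n with seq z N ℚ.≤? η ℚ.+ η
  ... | yes z≤2η = begin
    seq y n                                    ≡⟨ solve 2 (λ a b → a := b :+ (a :- b)) refl (seq y n) (seq x n) ⟩
    seq x n ℚ.+ seq z n                        ≤⟨ ℚ.+-monoʳ-≤ (seq x n) (ℚ.≤-trans (z-step n N N≤n ℕ.≤-refl) (ℚ.+-monoʳ-≤ η z≤2η)) ⟩
    seq x n ℚ.+ (η ℚ.+ (η ℚ.+ η))              ≤⟨ ≤-by-gap (seq x n ℚ.+ (η ℚ.+ (η ℚ.+ η))) η (ℚ.<⇒≤ 0<η)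
                                                    (solve 2 (λ x d → let h = con ½ :* (con ½ :* d) in x :+ (h :+ (h :+ h)) :+ h := x :+ d) refl (seq x n) δ) ⟩
    seq x n ℚ.+ δ                              ∎
  ... | no z≰2η = contradiction (η , 0<η , N , λ m N≤m → begin
    seq x m ℚ.+ η                              ≡⟨ solve 2 (λ x h → x :+ h := x :+ (h :+ h :- h)) refl (seq x m) η ⟩
    seq x m ℚ.+ (η ℚ.+ η ℚ.- η)                ≤⟨ ℚ.+-monoʳ-≤ (seq x m) (ℚ.+-monoˡ-≤ (ℚ.- η) (ℚ.<⇒≤ (ℚ.≰⇒> z≰2η))) ⟩
    seq x m ℚ.+ (seq z N ℚ.- η)                ≤⟨ ℚ.+-monoʳ-≤ (seq x m) (ℚ.+-monoˡ-≤ (ℚ.- η) (z-step N m ℕ.≤-refl N≤m)) ⟩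
    seq x m ℚ.+ (η ℚ.+ seq z m ℚ.- η)          ≡⟨ solve 3 (λ x h y → x :+ (h :+ (y :- x) :- h)
         := y) refl (seq x m) η (seq y m) ⟩
    seq y m                                    ∎) x≮y

-- The defining property of the inverse square root

-- With y = 1 / K, the choice of `root` gives x² d ≤ 1 ≤ (x + y)² d. Hence 0 ≤ 1 - x² d ≤ (2 x y +
-- y²) d ≤ 3 d y, the last step because x and y are at most 1; and y tends to 0.
1-s²d-null : ∀ d .{{_ : ℕ.NonZero d}} → Null (λ k → 1ℚ ℚ.- seq (invSqrt d) k ² ℚ.* ι d)
1-s²d-null d@(suc d-1) δ 0<δ =
  let η , 0<η , 3dη≤δ = shrink (ι 3 ℚ.* ι d) δ 0≤3d 0<δ
      N , 1/k≤η = archimedean η 0<η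
  in N , λ k N≤k → ∣∣≤
    (ℚ.≤-trans (upper k) (ℚ.≤-trans (ℚ.*-monoˡ-≤-nonNeg (ι 3 ℚ.* ι d) {{ℚ.nonNegative 0≤3d}} (1/k≤η k N≤k)) 3dη≤δ))
    (ℚ.≤-trans (lower k) (ℚ.<⇒≤ 0<δ))
  where
  open ℚ.≤-Reasoning
  0≤3d : 0ℚ ℚ.≤ ι 3 ℚ.* ι d
  0≤3d = 0≤* (0≤ι 3) (0≤ι d)
  module _ (k : ℕ) where
    K = suc k
    r = root d K K
    x y : ℚ
    x = seq (invSqrt d) k
    y = + 1 / K
    κ²-pos : ℚ.Positive (ι K ²)
    κ²-pos = ℚ.pos*pos⇒pos (ι K) {{ℚ.normalize-pos K 1}} (ι K) {{ℚ.normalize-pos K 1}}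
    -- Multiplying by K² turns the claims about `x` and `y + x` into the integer inequalities
    -- `root-lower` and `root-upper′`.
    fraction²d : ∀ a → (+ a / K) ² ℚ.* ι d ℚ.* ι K ² ≡ ι (a ℕ.* a ℕ.* d)
    fraction²d a = begin-equality
      (+ a / K) ² ℚ.* ι d ℚ.* ι K ²      ≡⟨ solve 3 (λ p q d → p :* p :* d :* (q :* q)
           := p :* q :* (p :* q) :* d) refl (+ a / K) (ι K) (ι d) ⟩
      ((+ a / K) ℚ.* ι K) ² ℚ.* ι d      ≡⟨ cong (λ p → p ² ℚ.* ι d) (a/d*d≡a a K) ⟩
      ι a ² ℚ.* ι d                      ≡⟨ cong (ℚ._* ι d) (ι-* a a) ⟨
      ι (a ℕ.* a) ℚ.* ι d                ≡⟨ ι-* (a ℕ.* a) d ⟨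
      ι (a ℕ.* a ℕ.* d)                  ∎
    x²d≤1 : x ² ℚ.* ι d ℚ.≤ 1ℚ
    x²d≤1 = ℚ.*-cancelʳ-≤-pos (ι K ²) {{κ²-pos}} (begin
      x ² ℚ.* ι d ℚ.* ι K ²      ≡⟨ fraction²d r ⟩
      ι (r ℕ.* r ℕ.* d)          ≤⟨ ι-mono (root-lower d K K) ⟩
      ι (K ℕ.* K)                ≡⟨ ι-* K K ⟩
      ι K ²                      ≡⟨ ℚ.*-identityˡ (ι K ²) ⟨
      1ℚ ℚ.* ι K ²               ∎)
    1≤[x+y]²d : 1ℚ ℚ.≤ (y ℚ.+ x) ² ℚ.* ι d
    1≤[x+y]²d = ℚ.*-cancelʳ-≤-pos (ι K ²) {{κ²-pos}} (begin
      1ℚ ℚ.* ι K ²                            ≡⟨ ℚ.*-identityˡ (ι K ²) ⟩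
      ι K ²                                   ≡⟨ ι-* K K ⟨
      ι (K ℕ.* K)                             ≤⟨ ι-mono (ℕ.<⇒≤ (root-upper′ d-1 K)) ⟩
      ι (suc r ℕ.* suc r ℕ.* d)               ≡⟨ fraction²d (suc r) ⟨
      (+ suc r / K) ² ℚ.* ι d ℚ.* ι K ²       ≡⟨ cong (λ p → p ² ℚ.* ι d ℚ.* ι K ²) (suc-/ r k) ⟩
      (y ℚ.+ x) ² ℚ.* ι d ℚ.* ι K ²           ∎)
    x≤1 : x ℚ.≤ 1ℚ
    x≤1 = square-cancel-≤ (ℚ.positive⁻¹ 1ℚ) (begin
      x ²              ≡⟨ ℚ.*-identityʳ (x ²) ⟨
      x ² ℚ.* 1ℚ       ≤⟨ ℚ.*-monoˡ-≤-nonNeg (x ²) {{ℚ.nonNegative (0≤p² x)}} (1≤ι d) ⟩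
      x ² ℚ.* ι d      ≤⟨ x²d≤1 ⟩
      1ℚ               ∎)
    0≤y : 0ℚ ℚ.≤ y
    0≤y = /-mono-≤ 0 0 1 k ℕ.z≤n
    y≤1 : y ℚ.≤ 1ℚ
    y≤1 = /-mono-≤ 1 k 1 0 (ℕ.s≤s ℕ.z≤n)
    lower : ℚ.- (1ℚ ℚ.- x ² ℚ.* ι d) ℚ.≤ 0ℚ
    lower = begin
      ℚ.- (1ℚ ℚ.- x ² ℚ.* ι d)      ≡⟨ solve 1 (λ p → :- (con 1ℚ :- p) := p :- con 1ℚ) refl (x ² ℚ.* ι d) ⟩
      x ² ℚ.* ι d ℚ.- 1ℚ            ≤⟨ ℚ.+-monoˡ-≤ (ℚ.- 1ℚ) x²d≤1 ⟩
      0ℚ                            ∎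
    upper : 1ℚ ℚ.- x ² ℚ.* ι d ℚ.≤ ι 3 ℚ.* ι d ℚ.* y
    upper = begin
      1ℚ ℚ.- x ² ℚ.* ι d
        ≤⟨ ℚ.+-monoˡ-≤ (ℚ.- (x ² ℚ.* ι d)) 1≤[x+y]²d ⟩
      (y ℚ.+ x) ² ℚ.* ι d ℚ.- x ² ℚ.* ι d
        ≤⟨ ≤-by-gap ((y ℚ.+ x) ² ℚ.* ι d ℚ.- x ² ℚ.* ι d) (ι d ℚ.* y ℚ.* (ι 2 ℚ.* (1ℚ ℚ.- x) ℚ.+ (1ℚ ℚ.- y)))
             (0≤* (0≤* (0≤ι d) 0≤y) (ℚ.+-mono-≤ (0≤* (0≤ι 2) (p≤q⇒0≤q-p x≤1)) (p≤q⇒0≤q-p y≤1)))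
             (solve 3 (λ x y d → (y :+ x) :* (y :+ x) :* d :- x :* x :* d :+ d :* y :* (con (ι 2) :* (con 1ℚ :- x) :+ (con 1ℚ :- y))
               := con (ι 3) :* d :* y) refl x y (ι d)) ⟩
      ι 3 ℚ.* ι d ℚ.* y ∎

-- The eigenvalue equation in terms of Dirichlet forms

sumℚ-0* : ∀ {n} (p : Vector ℚ n) → sumℚ (λ v → 0ℚ ℚ.* p v) ≡ 0ℚ
sumℚ-0* p = trans (sym (*-distribˡ-sumℚ 0ℚ p)) (ℚ.*-zeroˡ (sumℚ p))

sumℚ-- : ∀ {n} (f g : Vector ℚ n) → sumℚ (λ i → f i ℚ.- g i) ≡ sumℚ f ℚ.- sumℚ g
sumℚ-- f g = trans (sumℚ-distrib-+ f (λ i → ℚ.- g i)) (cong (sumℚ f ℚ.+_) (sumℚ-neg g))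

sumℚ-identity : ∀ {n} (p : Vector ℚ n) u → sumℚ (λ v → (if does (u Fin.≟ v) then 1ℚ else 0ℚ) ℚ.* p v) ≡ p u
sumℚ-identity p zero    = trans (cong₂ ℚ._+_ (ℚ.*-identityˡ (p zero)) (sumℚ-0* (p ∘ suc))) (ℚ.+-identityʳ (p zero))
sumℚ-identity p (suc u) = trans (cong₂ ℚ._+_ (ℚ.*-zeroˡ (p zero)) (sumℚ-identity (p ∘ suc) u)) (ℚ.+-identityˡ (p (suc u)))

-- A walk from `u` to some other vertex has a first step, which supplies a neighbour of `u`.
degree≢0 : ∀ {n} (G : SimpleGraph n) → Connected G → 2 ≤ n → ∀ u → ℕ.NonZero (degree G u)
degree≢0 G conn (ℕ.s≤s (ℕ.s≤s ℕ.z≤n)) u = ℕ.≢-nonZero (neighbour (proj₂ (other u)) (conn u (proj₁ (other u))))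
  where
  open SimpleGraph G
  other : ∀ {n} (u : Fin (suc (suc n))) → ∃ λ v → u ≢ v
  other zero    = suc zero , λ ()
  other (suc u) = zero , λ ()
  neighbour : ∀ {u v} → u ≢ v → Walk G u v → degree G u ≢ 0
  neighbour u≢v ε                   = contradiction refl u≢v
  neighbour _   (_◅_ {j = v} e _) = ℕ.n>0⇒n≢0 (List.filter-some (_ ~?_) (lose (∈-allFin v) e))

-- q u is the defect of the equation (T - A) f = μ T f at u.
dirichlet-defect : ∀ {n} (a : Fin n → Fin n → ℚ) (d f : Vector ℚ n) μ →
  (∀ u v → a u v ≡ a v u) → (∀ u → d u ≡ sumℚ (a u)) →
  let q = λ u → d u ℚ.* f u ℚ.- sumℚ (λ v → a u v ℚ.* f v) ℚ.- μ ℚ.* (d u ℚ.* f u)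
      V = sumℚ d
      S = sumℚ (λ u → d u ℚ.* f u)
  in sumℚ (λ u → ι 2 ℚ.* (V ℚ.* f u ℚ.- S) ℚ.* q u) ≡
     V ℚ.* dirichlet a f ℚ.- μ ℚ.* dirichlet (productWeights d) f
dirichlet-defect a d f μ a-sym d≡ = begin
  sumℚ (λ u → ι 2 ℚ.* (V ℚ.* f u ℚ.- S) ℚ.* q u)
    ≡⟨ sumℚ-cong (λ u → solve 4 (λ V S f q → con (ι 2) :* (V :* f :- S) :* q
         := con (ι 2) :* V :* (f :* q) :- con (ι 2) :* S :* q) refl V S (f u) (q u)) ⟩
  sumℚ (λ u → ι 2 ℚ.* V ℚ.* (f u ℚ.* q u) ℚ.- ι 2 ℚ.* S ℚ.* q u)
    ≡⟨ trans (sumℚ-- (λ u → ι 2 ℚ.* V ℚ.* (f u ℚ.* q u)) (λ u → ι 2 ℚ.* S ℚ.* q u))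
         (sym (cong₂ ℚ._-_ (*-distribˡ-sumℚ (ι 2 ℚ.* V) λ u → f u ℚ.* q u) (*-distribˡ-sumℚ (ι 2 ℚ.* S) q))) ⟩
  ι 2 ℚ.* V ℚ.* sumℚ (λ u → f u ℚ.* q u) ℚ.- ι 2 ℚ.* S ℚ.* sumℚ q
    ≡⟨ cong₂ (λ x y → ι 2 ℚ.* V ℚ.* x ℚ.- ι 2 ℚ.* S ℚ.* y) Σfq Σq ⟩
  ι 2 ℚ.* V ℚ.* (N ℚ.- C ℚ.- μ ℚ.* N) ℚ.- ι 2 ℚ.* S ℚ.* (S ℚ.- S ℚ.- μ ℚ.* S)
    ≡⟨ solve 5 (λ V N C S μ → con (ι 2) :* V :* (N :- C :- μ :* N) :- con (ι 2) :* S :* (S :- S :- μ :* S)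
         := V :* (con (ι 2) :* (N :- C)) :- μ :* (con (ι 2) :* (V :* N :- S :* S))) refl V N C S μ ⟩
  V ℚ.* (ι 2 ℚ.* (N ℚ.- C)) ℚ.- μ ℚ.* (ι 2 ℚ.* (V ℚ.* N ℚ.- S ²))
    ≡⟨ cong₂ (λ x y → V ℚ.* x ℚ.- μ ℚ.* y)
         (trans (dirichlet-expand a f a-sym) (cong (λ x → ι 2 ℚ.* (x ℚ.- C))
              (sumℚ-cong λ u → cong (ℚ._* f u ²) (sym (d≡ u)))))
         (dirichlet-productWeights d f) ⟨
  V ℚ.* dirichlet a f ℚ.- μ ℚ.* dirichlet (productWeights d) f ∎
  where
  open ≡-Reasoning
  V = sumℚ d
  S = sumℚ λ u → d u ℚ.* f u
  N = sumℚ λ u → d u ℚ.* f u ²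
  C = sumℚ λ u → sumℚ λ v → a u v ℚ.* (f u ℚ.* f v)
  A q : Vector ℚ _
  A u = sumℚ λ v → a u v ℚ.* f v
  q u = d u ℚ.* f u ℚ.- A u ℚ.- μ ℚ.* (d u ℚ.* f u)
  split : ∀ (x y z : Vector ℚ _) → sumℚ (λ u → x u ℚ.- y u ℚ.- μ ℚ.* z u) ≡ sumℚ x ℚ.- sumℚ y ℚ.- μ ℚ.* sumℚ z
  split x y z = trans (sumℚ-- (λ u → x u ℚ.- y u) (λ u → μ ℚ.* z u)) (cong₂ ℚ._-_ (sumℚ-- x y) (sym (*-distribˡ-sumℚ μ z)))
  Σfq : sumℚ (λ u → f u ℚ.* q u) ≡ N ℚ.- C ℚ.- μ ℚ.* N
  Σfq = begin
    sumℚ (λ u → f u ℚ.* q u)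
      ≡⟨ sumℚ-cong (λ u → solve 4 (λ d f A μ → f :* (d :* f :- A :- μ :* (d :* f))
           := d :* (f :* f) :- f :* A :- μ :* (d :* (f :* f))) refl (d u) (f u) (A u) μ) ⟩
    sumℚ (λ u → d u ℚ.* f u ² ℚ.- f u ℚ.* A u ℚ.- μ ℚ.* (d u ℚ.* f u ²))
      ≡⟨ split (λ u → d u ℚ.* f u ²) (λ u → f u ℚ.* A u) (λ u → d u ℚ.* f u ²) ⟩
    N ℚ.- sumℚ (λ u → f u ℚ.* A u) ℚ.- μ ℚ.* N
      ≡⟨ cong (λ c → N ℚ.- c ℚ.- μ ℚ.* N) (sumℚ-cong λ u → trans (*-distribˡ-sumℚ (f u) λ v → a u v ℚ.* f v)
           (sumℚ-cong λ v → solve 3 (λ f a g → f :* (a :* g) := a :* (f :* g)) refl (f u) (a u v) (f v))) ⟩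
    N ℚ.- C ℚ.- μ ℚ.* N ∎
  Σq : sumℚ q ≡ S ℚ.- S ℚ.- μ ℚ.* S
  Σq = begin
    sumℚ q                                ≡⟨ split (λ u → d u ℚ.* f u) A (λ u → d u ℚ.* f u) ⟩
    S ℚ.- sumℚ A ℚ.- μ ℚ.* S              ≡⟨ cong (λ c → S ℚ.- c ℚ.- μ ℚ.* S) (trans (sumℚ-comm λ u v → a u v ℚ.* f v)
                                               (sumℚ-cong λ v → trans (sym (*-distribʳ-sumℚ (f v) λ u → a u v))
                                                 (cong (ℚ._* f v) (trans (sumℚ-cong λ u → a-sym u v) (sym (d≡ v)))))) ⟩
    S ℚ.- S ℚ.- μ ℚ.* S                   ∎

-- Eigenvectors of the normalized Laplacian with small eigenvalue

module _ {n} (G : SimpleGraph n) where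

  private
    d : Vector ℚ n
    d u = ι (degree G u)

    a : Fin n → Fin n → ℚ
    a = adjacencyℚ G

    s : Vector ℝ n
    s u = invSqrt (degree G u)

  -- This is T^(-1/2) φ, known as the harmonic eigenfunction when φ is an eigenvector.
  harmonic : Vector ℝ n → Vector ℝ n
  harmonic φ u = s u *ᵣ φ u

  seq-normalizedLaplacian : ∀ φ u k → seq ((normalizedLaplacian G ·ᵥ φ) u) k ≡
    seq (φ u) k ℚ.- seq (s u) k ℚ.* sumℚ (λ v → a u v ℚ.* seq (harmonic φ v) k)
  seq-normalizedLaplacian φ u k = begin
    seq ((normalizedLaplacian G ·ᵥ φ) u) k
      ≡⟨ seq-sumᵣ (λ v → normalizedLaplacian G u v *ᵣ φ v) k ⟩
    sumℚ (λ v → (seq (identity u v) k ℚ.- seq (s u) k ℚ.* seq (adjacency G u v) k ℚ.* seq (s v) k) ℚ.* seq (φ v) k)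
      ≡⟨ sumℚ-cong (λ v → trans
           (cong₂ (λ i b → (i ℚ.- seq (s u) k ℚ.* b ℚ.* seq (s v) k) ℚ.* seq (φ v) k)
             -- `if-float` moves `seq` into the branches, turning the real entries 0 and 1 into
             -- rational ones.
             (if-float (λ x → seq x k) (does (u Fin.≟ v))) (if-float (λ x → seq x k) (does (SimpleGraph._~?_ G u v))))
           (solve 5 (λ i s b t p → (i :- s :* b :* t) :* p := i :* p :- s :* (b :* (t :* p))) refl
             (I v) (seq (s u) k) (a u v) (seq (s v) k) (seq (φ v) k))) ⟩
    sumℚ (λ v → I v ℚ.* seq (φ v) k ℚ.- seq (s u) k ℚ.* (a u v ℚ.* seq (harmonic φ v) k))
      ≡⟨ trans (sumℚ-- (λ v → I v ℚ.* seq (φ v) k) (λ v → seq (s u) k ℚ.* (a u v ℚ.* seq (harmonic φ v) k)))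
           (cong₂ ℚ._-_ (sumℚ-identity (λ v → seq (φ v) k) u)
                (sym (*-distribˡ-sumℚ (seq (s u) k) λ v → a u v ℚ.* seq (harmonic φ v) k))) ⟩
    seq (φ u) k ℚ.- seq (s u) k ℚ.* sumℚ (λ v → a u v ℚ.* seq (harmonic φ v) k) ∎
    where
    open ≡-Reasoning
    I : Vector ℚ n
    I v = if does (u Fin.≟ v) then 1ℚ else 0ℚ

  HarmonicConstant : Vector ℝ n → Set
  HarmonicConstant φ = ∀ u v → Null (λ k → seq (harmonic φ u) k ℚ.- seq (harmonic φ v) k)

  module _ (d≢0 : ∀ u → ℕ.NonZero (degree G u)) where

    private
      -- At a fixed index s² d = 1 holds only approximately; each cancellation of s² against d below
      -- leaves a multiple of this null error.
      e : Fin n → ℕ → ℚ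
      e u k = 1ℚ ℚ.- seq (s u) k ² ℚ.* d u

      e-null : ∀ u → Null (e u)
      e-null u = 1-s²d-null (degree G u) {{d≢0 u}}

    module _ {μ φ} (eigen : IsEigenpair (normalizedLaplacian G) μ φ) where

      private
        f : Vector ℝ n
        f = harmonic φ

        fₖ : ℕ → Vector ℚ n
        fₖ k u = seq (f u) k

        A q : Fin n → ℕ → ℚ
        A u k = sumℚ λ v → a u v ℚ.* fₖ k v
        q u k = d u ℚ.* fₖ k u ℚ.- A u k ℚ.- seq μ k ℚ.* (d u ℚ.* fₖ k u)

        -- The negative of `A` as a real, since `null-*` asks for a Cauchy factor; `Sᵣ` is
        -- introduced for the same reason.
        -Aᵣ : Vector ℝ n
        -Aᵣ u = -ᵣ sumᵣ λ v → fromℚ (a u v) *ᵣ f v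

        S : ℕ → ℚ
        S k = sumℚ λ u → d u ℚ.* fₖ k u

        Sᵣ : ℝ
        Sᵣ = sumᵣ λ u → fromℚ (d u) *ᵣ f u

      -- The eigenvalue equation at `u` is multiplied by d s, the approximate square root of d. This
      -- turns s A into s² d A, and the term - A e restores A.
      harmonic-equation : ∀ u → Null (q u)
      harmonic-equation u = null-cong
        (λ k → trans
          (cong₂ (λ m b → d u ℚ.* seq (s u) k ℚ.* (m ℚ.- seq μ k ℚ.* seq (φ u) k) ℚ.+ (ℚ.- b) ℚ.* e u k)
            (seq-normalizedLaplacian φ u k) (seq-sumᵣ (λ v → fromℚ (a u v) *ᵣ f v) k))
          (solve 5 (λ d s p A μ → d :* s :* (p :- s :* A :- μ :* p) :+ :- A :* (con 1ℚ :- s :* s :* d)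
              := d :* (s :* p) :- A :- μ :* (d :* (s :* p)))
              refl (d u) (seq (s u) k) (seq (φ u) k) (A u k) (seq μ k)))
        (null-+ (null-* (fromℚ (d u) *ᵣ s u) (eigen u)) (null-* (-Aᵣ u) (e-null u)))

      -- The null defect `q` is paired with 2 (V f - S), which is `f` shifted to d-weighted mean
      -- zero and scaled by 2 V. By `dirichlet-defect` the pairing is V E - μ W.
      dirichlet-eigen : Null λ k → sumℚ d ℚ.* dirichlet a (fₖ k) ℚ.- seq μ k ℚ.* dirichlet (productWeights d) (fₖ k)
      dirichlet-eigen = null-cong
        (λ k → trans
          (sumℚ-cong λ u → cong (λ t → ι 2 ℚ.* (sumℚ d ℚ.* fₖ k u ℚ.- t) ℚ.* q u k) (seq-sumᵣ (λ u → fromℚ (d u) *ᵣ f u) k))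
          (dirichlet-defect a d (fₖ k) (seq μ k) (adjacencyℚ-sym G) (ι-degree G)))
        (null-sum λ u → null-* (fromℚ (ι 2) *ᵣ (fromℚ (sumℚ d) *ᵣ f u -ᵣ Sᵣ)) (harmonic-equation u))

      -- All degrees are at least 1, so the pair (u, v) alone already contributes this much to the
      -- sum of nonnegative terms.
      difference²≤dirichlet : ∀ k u v → (fₖ k u ℚ.- fₖ k v) ² ℚ.≤ dirichlet (productWeights d) (fₖ k)
      difference²≤dirichlet k u v = begin
        x ²                                           ≡⟨ solve 1 (λ x → x := con 1ℚ :* con 1ℚ :* x) refl (x ²) ⟩
        1ℚ ℚ.* 1ℚ ℚ.* x ²                             ≤⟨ ℚ.*-monoʳ-≤-nonNeg (x ²) {{ℚ.nonNegative (0≤p² x)}}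
                                                           (*-mono-≤-0≤ {1ℚ} {d u} {1ℚ} {d v} (0≤ι 1) (0≤ι (degree G u)) (1≤ι (degree G u) {{d≢0 u}}) (1≤ι (degree G v) {{d≢0 v}})) ⟩
        d u ℚ.* d v ℚ.* x ²                           ≤⟨ term≤sumℚ (t u) (0≤t u) v ⟩
        sumℚ (t u)                                    ≤⟨ term≤sumℚ (λ u → sumℚ (t u)) (λ u → sumℚ-nonneg (0≤t u)) u ⟩
        dirichlet (productWeights d) (fₖ k)           ∎
        where
        open ℚ.≤-Reasoning
        x = fₖ k u ℚ.- fₖ k v
        t : Fin n → Fin n → ℚ
        t u v = d u ℚ.* d v ℚ.* (fₖ k u ℚ.- fₖ k v) ²
        0≤t : ∀ u v → 0ℚ ℚ.≤ t u v
        0≤t u v = 0≤* (0≤* (0≤ι (degree G u)) (0≤ι (degree G v))) (0≤p² (fₖ k u ℚ.- fₖ k v))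

      -- A gap γ between μ and c, where D vol(G) c = 4, turns the Poincaré inequality
      -- into γ W ≤ vol(G) E - μ W, whose right-hand side tends to 0.
      harmonic-constant : Connected G → ∀ {D} .{{_ : ℕ.NonZero D}} .{{_ : ℕ.NonZero (D ℕ.* vol G)}} → IsDiameter G D →
        μ <ᵣ fromℚ (+ 4 / (D ℕ.* vol G)) → HarmonicConstant φ
      harmonic-constant conn {D} diam (γ , 0<γ , N₁ , gap) u v δ 0<δ = N₁ ℕ.⊔ N₂ , λ k N≤k →
        square≤⇒∣∣≤ 0<δ (ℚ.≤-trans (difference²≤dirichlet k u v)
          (W≤δ² k (gap k (ℕ.m⊔n≤o⇒m≤o N₁ N₂ N≤k)) (near k (ℕ.m⊔n≤o⇒n≤o N₁ N₂ N≤k))))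
        where
        open ℚ.≤-Reasoning
        0<γδ² : 0ℚ ℚ.< γ ℚ.* δ ²
        0<γδ² = ℚ.positive⁻¹ (γ ℚ.* δ ²) {{ℚ.pos*pos⇒pos γ {{ℚ.positive 0<γ}} (δ ²)
          {{ℚ.pos*pos⇒pos δ {{ℚ.positive 0<δ}} δ {{ℚ.positive 0<δ}}}}}}
        -- The tolerance γ δ² is chosen so that γ W ≤ γ δ² yields W ≤ δ², and hence differences of
        -- `f` of size at most δ.
        N₂ = proj₁ (dirichlet-eigen (γ ℚ.* δ ²) 0<γδ²)
        near = proj₂ (dirichlet-eigen (γ ℚ.* δ ²) 0<γδ²)
        c : ℚ
        c = + 4 / (D ℕ.* vol G)
        V = sumℚ d
        W E : ℕ → ℚ
        W k = dirichlet (productWeights d) (fₖ k)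
        E k = dirichlet a (fₖ k)
        m = ι (D ℕ.* vol G)
        0≤W : ∀ k → 0ℚ ℚ.≤ W k
        0≤W k = ℚ.≤-trans (0≤p² (fₖ k u ℚ.- fₖ k v)) (difference²≤dirichlet k u v)
        cW≤VE : ∀ k → c ℚ.* W k ℚ.≤ V ℚ.* E k
        cW≤VE k = ℚ.*-cancelˡ-≤-pos m {{ℚ.normalize-pos (D ℕ.* vol G) 1}} (begin
          m ℚ.* (c ℚ.* W k)                         ≡⟨ solve 3 (λ m c W → m :* (c :* W)
               := c :* m :* W) refl m c (W k) ⟩
          c ℚ.* m ℚ.* W k                           ≡⟨ cong (ℚ._* W k) (a/d*d≡a 4 (D ℕ.* vol G)) ⟩
          ι 4 ℚ.* W k                               ≤⟨ poincaré G conn diam (fₖ k) ⟩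
          ι D ℚ.* ι (vol G) ℚ.* (ι (vol G) ℚ.* E k) ≡⟨ cong₂ (λ x y → x ℚ.* (y ℚ.* E k)) (sym (ι-* D (vol G))) (ι-sum (degree G)) ⟩
          m ℚ.* (V ℚ.* E k)                         ∎)
        W≤δ² : ∀ k → seq μ k ℚ.+ γ ℚ.≤ c → ℚ.∣ V ℚ.* E k ℚ.- seq μ k ℚ.* W k ∣ ℚ.≤ γ ℚ.* δ ² → W k ℚ.≤ δ ²
        W≤δ² k μ+γ≤c small = ℚ.*-cancelˡ-≤-pos γ {{ℚ.positive 0<γ}} (begin
          γ ℚ.* W k                                         ≡⟨ solve 3 (λ γ μ W → γ :* W
               := (μ :+ γ) :* W :- μ :* W) refl γ (seq μ k) (W k) ⟩
          (seq μ k ℚ.+ γ) ℚ.* W k ℚ.- seq μ k ℚ.* W k       ≤⟨ ℚ.+-monoˡ-≤ (ℚ.- (seq μ k ℚ.* W k)) (ℚ.*-monoʳ-≤-nonNeg (W k) {{ℚ.nonNegative (0≤W k)}} μ+γ≤c) ⟩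
          c ℚ.* W k ℚ.- seq μ k ℚ.* W k                     ≤⟨ ℚ.+-monoˡ-≤ (ℚ.- (seq μ k ℚ.* W k)) (cW≤VE k) ⟩
          V ℚ.* E k ℚ.- seq μ k ℚ.* W k                     ≤⟨ ℚ.≤-trans (p≤∣p∣ (V ℚ.* E k ℚ.- seq μ k ℚ.* W k)) small ⟩
          γ ℚ.* δ ²                                         ∎)

    private
      -- Undoes the scaling by `s`: d s (s φ) equals φ up to φ e. The value of `harmonic φ` at `u`
      -- is split through its value at `v`, so that constancy can be used.
      φ≡ : ∀ φ u v k → seq (φ u) k ≡
        d u ℚ.* seq (s u) k ℚ.* (seq (harmonic φ u) k ℚ.- seq (harmonic φ v) k) ℚ.+
        (d u ℚ.* seq (s u) k ℚ.* seq (harmonic φ v) k ℚ.+ seq (φ u) k ℚ.* e u k)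
      φ≡ φ u v k = solve 4 (λ d s p g → p
           := d :* s :* (s :* p :- g) :+ (d :* s :* g :+ p :* (con 1ℚ :- s :* s :* d))) refl
        (d u) (seq (s u) k) (seq (φ u) k) (seq (harmonic φ v) k)

    null-harmonic⇒null : ∀ φ → HarmonicConstant φ → ∀ {v} → Null (seq (harmonic φ v)) → ∀ u → Null (seq (φ u))
    null-harmonic⇒null φ const {v} null u = null-cong (λ k → sym (φ≡ φ u v k))
      (null-+ (null-* (fromℚ (d u) *ᵣ s u) (const u v))
        (null-+ (null-* (fromℚ (d u) *ᵣ s u) null) (null-* (φ u) (e-null u))))

    -- If `harmonic φ` and `harmonic ψ` are constants g and h, then φ = g T^(1/2) 1 and ψ = h
    -- T^(1/2) 1, so h φ - g ψ = 0. The identity below records this with the errors from constancy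
    -- and from `e`.
    harmonic-cross : ∀ φ ψ → HarmonicConstant φ → HarmonicConstant ψ → ∀ u v →
      Null (λ k → seq (harmonic ψ v) k ℚ.* seq (φ u) k ℚ.- seq (harmonic φ v) k ℚ.* seq (ψ u) k)
    harmonic-cross φ ψ φ-const ψ-const u v = null-cong
      (λ k → solve 6 (λ d s p q g h →
          h :* d :* s :* (s :* p :- g) :+ (:- (g :* d :* s) :* (s :* q :- h) :+ (h :* p :- g :* q) :* (con 1ℚ :- s :* s :* d))
          := h :* p :- g :* q) refl
        (d u) (seq (s u) k) (seq (φ u) k) (seq (ψ u) k) (seq (harmonic φ v) k) (seq (harmonic ψ v) k))
      (null-+ (null-* (harmonic ψ v *ᵣ fromℚ (d u) *ᵣ s u) (φ-const u v))
        (null-+ (null-* (-ᵣ (harmonic φ v *ᵣ fromℚ (d u) *ᵣ s u)) (ψ-const u v))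
          (null-* (harmonic ψ v *ᵣ φ u -ᵣ harmonic φ v *ᵣ ψ u) (e-null u))))

-- Linear dependence of two such eigenvectors, and the conclusion

1-not-null : ¬ Null (λ _ → 1ℚ)
1-not-null null with N , h ← null ½ (ℚ.positive⁻¹ ½) = contradiction (h N ℕ.≤-refl) (from-no (1ℚ ℚ.≤? ½))

firstTwo : ∀ {m} → ℝ → ℝ → Vector ℝ (suc (suc m))
firstTwo x y zero          = x
firstTwo x y (suc zero)    = y
firstTwo x y (suc (suc i)) = 0ᵣ

seq-firstTwo : ∀ {m} x y (z : Vector ℝ (suc (suc m))) k → seq (sumᵣ (λ i → firstTwo x y i *ᵣ z i)) k ≡
  seq x k ℚ.* seq (z zero) k ℚ.+ seq y k ℚ.* seq (z (suc zero)) k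
seq-firstTwo x y z k = trans (seq-sumᵣ (λ i → firstTwo x y i *ᵣ z i) k)
  (cong (seq x k ℚ.* seq (z zero) k ℚ.+_)
    (trans (cong (seq y k ℚ.* seq (z (suc zero)) k ℚ.+_) (sumℚ-0* (λ i → seq (z (suc (suc i))) k)))
           (ℚ.+-identityʳ (seq y k ℚ.* seq (z (suc zero)) k))))

-- Whether a real is 0 cannot be decided, so independence is used twice instead of a case split. It
-- first forces the constant g₀ of φ₀ to be null. Then φ₀ itself is null, and the coefficients (1,
-- 0, 0, ...) contradict independence.
constant⇒dependent : ∀ {n m} (G : SimpleGraph n) (d≢0 : ∀ u → ℕ.NonZero (degree G u)) → Fin n →
  (φ : Fin (suc (suc m)) → Vector ℝ n) →
  HarmonicConstant G (φ zero) → HarmonicConstant G (φ (suc zero)) → ¬ LinearlyIndependent φ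
constant⇒dependent G d≢0 v φ const₀ const₁ independent = 1-not-null (≈ᵣ0⇒null 1ᵣ
  (independent (firstTwo 1ᵣ 0ᵣ) (λ u → null⇒≈ᵣ0 (sumᵣ λ i → firstTwo 1ᵣ 0ᵣ i *ᵣ φ i u)
    (null-cong (λ k → trans (solve 2 (λ x y → x
         := con 1ℚ :* x :+ con 0ℚ :* y) refl (seq (φ zero u) k) (seq (φ (suc zero) u) k))
                        (sym (seq-firstTwo 1ᵣ 0ᵣ (λ i → φ i u) k)))
      (φ₀-null u))) zero))
  where
  g₀ g₁ : ℝ
  g₀ = harmonic G (φ zero) v
  g₁ = harmonic G (φ (suc zero)) v
  -g₀-null : Null (seq (-ᵣ g₀))
  -- The coefficients (g₁, -g₀, 0, ...) give the combination that vanishes by `harmonic-cross`; the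
  -- conclusion is read off at the second index.
  -g₀-null = ≈ᵣ0⇒null (-ᵣ g₀) (independent (firstTwo g₁ (-ᵣ g₀)) (λ u → null⇒≈ᵣ0 (sumᵣ λ i → firstTwo g₁ (-ᵣ g₀) i *ᵣ φ i u)
    (null-cong (λ k → trans (cong (seq g₁ k ℚ.* seq (φ zero u) k ℚ.+_) (ℚ.neg-distribˡ-* (seq g₀ k) (seq (φ (suc zero) u) k)))
                        (sym (seq-firstTwo g₁ (-ᵣ g₀) (λ i → φ i u) k)))
      (harmonic-cross G d≢0 (φ zero) (φ (suc zero)) const₀ const₁ u v))) (suc zero))
  φ₀-null : ∀ u → Null (seq (φ zero u))
  φ₀-null = null-harmonic⇒null G d≢0 (φ zero) const₀ (null-cong
    (λ k → solve 1 (λ g → con (ℚ.- 1ℚ) :* :- g := g) refl (seq g₀ k)) (null-* (-ᵣ 1ᵣ) -g₀-null))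

theorem1p3 : (n : ℕ) (2≤n : 2 ≤ n) (G : SimpleGraph n) (connected : Connected G)
    (D : ℕ) (diameter : IsDiameter G D)
    (λs : Fin n → ℝ) → IsSpectrum (normalizedLaplacian G) λs →
    λs (fromℕ< 2≤n) ≥ᵣ fromℚ (_/_ (+ 4) (D * vol G) {{D*vol-nonZero G connected 2≤n diameter}})
theorem1p3 (suc (suc n)) 2≤n@(ℕ.s≤s (ℕ.s≤s ℕ.z≤n)) G connected D diameter λs (sorted , φ , eigen , independent) =
  -- Refuting λ₁ < c is enough. As the eigenvalues are sorted, the first one would inherit a gap
  -- below `c`, so both of the first two eigenvectors would have constant harmonic functions.
  ≮ᵣ⇒≥ᵣ λ₁ c λ λ₁<c → constant⇒dependent G d≢0 zero φ
    (constant zero (≤ᵣ-<ᵣ-trans (λs zero) λ₁ c (sorted zero (suc zero) ℕ.z≤n) λ₁<c))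
    (constant (suc zero) λ₁<c) independent
  where
  instance
    D*vol≢0 : ℕ.NonZero (D ℕ.* vol G)
    D*vol≢0 = D*vol-nonZero G connected 2≤n diameter
    D≢0 : ℕ.NonZero D
    D≢0 = ℕ.m*n≢0⇒m≢0 D
  λ₁ = λs (suc zero)
  c = fromℚ (+ 4 / (D ℕ.* vol G))
  d≢0 : ∀ u → ℕ.NonZero (degree G u)
  d≢0 = degree≢0 G connected 2≤n
  constant : ∀ i → λs i <ᵣ c → HarmonicConstant G (φ i)
  constant i = harmonic-constant G d≢0 {λs i} {φ i} (eigen i) connected diameter
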